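{- There exist a function $\alpha=\alpha(n)=O(\log n)$ (with $b=\alpha n$ a positive integer) and an efficient non-deterministic algorithm that, on input $a_1,\dots,a_n\in\{0,\dots,2^b-1\}$ drawn i.i.d. uniformly at random, certifies that no perfect partition of $a_1,\dots,a_n$ exists with high probability. Precisely: there is a deterministic verifier $V$, running in time polynomial in $n$ and $b$, taking as input integers $a_1,\dots,a_n\in\{0,\dots,2^b-1\}$ and a witness string $w$ of size polynomial in $n$ and $b$, such that: (i) for every $a_1,\dots,a_n\in\{0,\dots,2^b-1\}$ that has a perfect partition, there is no witness $w$ for which $V(a_1,\dots,a_n,w)$ accepts; (ii) if $a_1,\dots,a_n$ are drawn i.i.d. uniformly at random from $\{0,\dots,2^b-1\}$, then with high probability there exists a witness $w$ of polynomial size such that $V(a_1,\dots,a_n,w)$ accepts.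
   Context: A perfect partition of integers $a_1,\dots,a_n$ is a subset $S\subseteq\{1,\dots,n\}$ such that $\left|\sum_{i\in S}a_i-\sum_{i\notin S}a_i\right|\le 1$. "With high probability" means with probability $1-o(1)$ as $n\to\infty$. An efficient non-deterministic certification algorithm is one for which there is a polynomial-size witness that exists with high probability for the random instance, does not exist for any instance having a perfect partition, and can be verified (but not necessarily computed) in polynomial time. -}

module Defs where

open import Data.Bool.Base using (Bool; true; false; if_then_else_)
open import Data.Fin.Base using (Fin; toℕ) renaming (zero to fzero)
open import Data.Fin.Subset using (Subset; ∁)
open import Data.Integer.Base as ℤ using (ℤ; 0ℤ)
open import Data.List.Base as List using (List; []; _∷_)
open import Data.Maybe.Base using (just)
open import Data.Nat.Base as ℕ using (ℕ; zero; suc; _+_; _*_; _^_; _≤_; _≡ᵇ_; NonZero)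
open import Data.Nat.DivMod using (_/_; _%_)
open import Data.Nat.Logarithm using (⌊log₂_⌋)
open import Data.Nat.Properties using (m^n≢0)
open import Data.Product.Base using (Σ-syntax; ∃-syntax; _×_; _,_)
open import Data.Rational.Base as ℚ using (ℚ; 0ℚ; 1ℚ)
open import Data.Vec.Base as Vec using (Vec; []; _∷_; lookup; _[_]≔_)
open import Relation.Binary.PropositionalEquality using (_≡_; refl; sym; trans)
open import Relation.Unary using (Pred; Decidable)
open import Level using (0ℓ)

sumOver : ∀ {n} → Subset n → Vec ℤ n → ℤ
sumOver S a = Vec.foldr′ ℤ._+_ 0ℤ (Vec.zipWith (λ s x → if s then x else 0ℤ) S a)

IsPerfectPartition : ∀ {n} → Vec ℤ n → Subset n → Set
IsPerfectPartition a S = ℤ.∣ sumOver S a ℤ.- sumOver (∁ S) a ∣ ≤ 1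

HasPerfectPartition : ∀ {n} → Vec ℤ n → Set
HasPerfectPartition {n} a = ∃[ S ] IsPerfectPartition a S

Instance : (n b : ℕ) → Set
Instance n b = Vec (Fin (2 ^ b)) n

integers : ∀ {M n} → Vec (Fin M) n → Vec ℤ n
integers = Vec.map (λ x → ℤ.+ toℕ x)

ℕ→ℚ : ℕ → ℚ
ℕ→ℚ m = ℤ.+ m ℚ./ 1

-- f(n) = O(log n).  Since ⌊log₂ n⌋ ≤ log₂ n ≤ 2⌊log₂ n⌋ for n ≥ 2, neither
-- the rounding nor the base of the logarithm matters.
O[log] : (ℕ → ℚ) → Set
O[log] f = ∃[ C ] ∃[ N ] ∀ n → N ≤ n → ℚ.∣ f n ∣ ℚ.≤ C ℚ.* ℕ→ℚ ⌊log₂ n ⌋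

-- Polynomials in n and b with natural number coefficients.
infixl 6 _⊕_
infixl 7 _⊗_

data Polynomial : Set where
  con     : ℕ → Polynomial
  𝐧 𝐛     : Polynomial
  _⊕_ _⊗_ : Polynomial → Polynomial → Polynomial

⟦_⟧ : Polynomial → (n b : ℕ) → ℕ
⟦ con c ⟧ n b = c
⟦ 𝐧     ⟧ n b = n
⟦ 𝐛     ⟧ n b = b
⟦ p ⊕ q ⟧ n b = ⟦ p ⟧ n b + ⟦ q ⟧ n b
⟦ p ⊗ q ⟧ n b = ⟦ p ⟧ n b * ⟦ q ⟧ n b

-- Each element of Vec (Fin M) n occurs exactly once.
allVecs : ∀ M n → List (Vec (Fin M) n)
allVecs M zero    = [] ∷ []
allVecs M (suc n) = List.cartesianProductWith _∷_ (List.allFin M) (allVecs M n)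

-- The probability of E when the n entries are i.i.d. uniform in Fin M: the
-- fraction of the M^n equally likely outcomes that lie in E.
ℙ : ∀ {M n} .{{_ : NonZero M}} {E : Pred (Vec (Fin M) n) 0ℓ} → Decidable E → ℚ
ℙ {M} {n} E? =
  (ℤ.+ List.length (List.filter E? (allVecs M n)) ℚ./ (M ^ n)) {{m^n≢0 M n}}

-- P(E n) = 1 − o(1) for a uniformly random instance of width b n.  Counting
-- the outcomes in E n requires a decision procedure; the value of the
-- probability does not depend on which one is used.
WithHighProbability : (b : ℕ → ℕ) → (∀ n → Pred (Instance n (b n)) 0ℓ) → Set
WithHighProbability b E =
  Σ[ E? ∈ (∀ n → Decidable (E n)) ]
    (∀ ε → 0ℚ ℚ.< ε →
      ∃[ N ] ∀ n → N ≤ n → 1ℚ ℚ.- ε ℚ.≤ ℙ {{m^n≢0 2 (b n)}} (E? n))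

-- Model of computation: structured programs over k registers, each holding a
-- bit string.  A step copies a register, adds or removes one leading bit, or
-- inspects one leading bit, and costs one time unit.  Since a step lengthens
-- the longest register by at most one bit, a multitape Turing machine
-- simulates t steps in time polynomial in t and the input length; conversely,
-- pairs of registers act as Turing machine tapes with constant overhead.  So
-- polynomial time here is the usual polynomial time.

infixr 5 _⨾_
infix  6 _≔_

data Program (k : ℕ) : Set where
  _≔_   : (x y : Fin k) → Program k
  push  : (x : Fin k) → Bool → Program k
  pop   : (x : Fin k) → Program k
  _⨾_   : (c d : Program k) → Program k
  -- case x c d e runs c, d or e according to whether x is empty, has leading
  -- bit false, or has leading bit true.
  case  : (x : Fin k) (c d e : Program k) → Program k
  -- while x c repeats c as long as x is nonempty.
  while : (x : Fin k) (c : Program k) → Program k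

Store : ℕ → Set
Store k = Vec (List Bool) k

-- c , s ⇓ s′ ⟨ t ⟩: started in store s, c halts in store s′ after t steps.
infix 4 _,_⇓_⟨_⟩

data _,_⇓_⟨_⟩ {k : ℕ} : Program k → Store k → Store k → ℕ → Set where
  ⇓-copy : ∀ {x y s} → x ≔ y , s ⇓ s [ x ]≔ lookup s y ⟨ 1 ⟩
  ⇓-push : ∀ {x v s} → push x v , s ⇓ s [ x ]≔ (v ∷ lookup s x) ⟨ 1 ⟩
  ⇓-pop  : ∀ {x s} → pop x , s ⇓ s [ x ]≔ List.drop 1 (lookup s x) ⟨ 1 ⟩
  ⇓-seq  : ∀ {c d s s′ s″ t u} →
           c , s ⇓ s′ ⟨ t ⟩ → d , s′ ⇓ s″ ⟨ u ⟩ → c ⨾ d , s ⇓ s″ ⟨ t + u ⟩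
  ⇓-case-[] : ∀ {x c d e s s′ t} →
           lookup s x ≡ [] → c , s ⇓ s′ ⟨ t ⟩ → case x c d e , s ⇓ s′ ⟨ suc t ⟩
  ⇓-case-false : ∀ {x c d e s s′ t l} →
           lookup s x ≡ false ∷ l → d , s ⇓ s′ ⟨ t ⟩ → case x c d e , s ⇓ s′ ⟨ suc t ⟩
  ⇓-case-true : ∀ {x c d e s s′ t l} →
           lookup s x ≡ true ∷ l → e , s ⇓ s′ ⟨ t ⟩ → case x c d e , s ⇓ s′ ⟨ suc t ⟩
  ⇓-while-[] : ∀ {x c s} →
           lookup s x ≡ [] → while x c , s ⇓ s ⟨ 1 ⟩
  ⇓-while-∷ : ∀ {x c s s′ s″ t u v l} →
           lookup s x ≡ v ∷ l → c , s ⇓ s′ ⟨ t ⟩ → while x c , s′ ⇓ s″ ⟨ u ⟩ →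
           while x c , s ⇓ s″ ⟨ suc (t + u) ⟩

private
  clash : ∀ {A B : Set} {l : List A} {x xs} → l ≡ [] → l ≡ x ∷ xs → B
  clash refl ()

  clashᵇ : ∀ {B : Set} {l : List Bool} {xs ys} → l ≡ false ∷ xs → l ≡ true ∷ ys → B
  clashᵇ refl ()

deterministic : ∀ {k} {c : Program k} {s s₁ s₂ t₁ t₂} →
  c , s ⇓ s₁ ⟨ t₁ ⟩ → c , s ⇓ s₂ ⟨ t₂ ⟩ → s₁ ≡ s₂ × t₁ ≡ t₂
deterministic ⇓-copy ⇓-copy = refl , refl
deterministic ⇓-push ⇓-push = refl , refl
deterministic ⇓-pop  ⇓-pop  = refl , refl
deterministic (⇓-seq p q) (⇓-seq p′ q′) with deterministic p p′
... | refl , refl with deterministic q q′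
... | refl , refl = refl , refl
deterministic (⇓-case-[] _ p) (⇓-case-[] _ p′) with deterministic p p′
... | refl , refl = refl , refl
deterministic (⇓-case-[] e _) (⇓-case-false e′ _) = clash e e′
deterministic (⇓-case-[] e _) (⇓-case-true e′ _)  = clash e e′
deterministic (⇓-case-false e _) (⇓-case-[] e′ _) = clash e′ e
deterministic (⇓-case-false _ p) (⇓-case-false _ p′) with deterministic p p′
... | refl , refl = refl , refl
deterministic (⇓-case-false e _) (⇓-case-true e′ _) = clashᵇ e e′
deterministic (⇓-case-true e _) (⇓-case-[] e′ _)    = clash e′ e
deterministic (⇓-case-true e _) (⇓-case-false e′ _) = clashᵇ e′ e
deterministic (⇓-case-true _ p) (⇓-case-true _ p′) with deterministic p p′
... | refl , refl = refl , refl
deterministic (⇓-while-[] _) (⇓-while-[] _) = refl , refl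
deterministic (⇓-while-[] e) (⇓-while-∷ e′ _ _) = clash e e′
deterministic (⇓-while-∷ e _ _) (⇓-while-[] e′) = clash e′ e
deterministic (⇓-while-∷ _ p q) (⇓-while-∷ _ p′ q′) with deterministic p p′
... | refl , refl with deterministic q q′
... | refl , refl = refl , refl

Witness : Set
Witness = List Bool

-- The b low-order binary digits, least significant first.
binary : (b m : ℕ) → List Bool
binary zero    m = []
binary (suc b) m = (m % 2 ≡ᵇ 1) ∷ binary b (m / 2)

-- The concatenated b-bit binary representations of a₁, …, aₙ.
encode : ∀ n b → Instance n b → List Bool
encode n b a = List.concatMap (λ x → binary b (toℕ x)) (Vec.toList a)

record Verifier : Set where
  field
    work    : ℕ
    program : Program (4 + work)

-- n and b are supplied in unary, which delimits the concatenated encoding.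
input : ∀ k n b → Instance n b → Witness → Store (4 + k)
input k n b a w =
  List.replicate n true ∷ List.replicate b true ∷ encode n b a ∷ w ∷ Vec.replicate k []

module _ (V : Verifier) (n b : ℕ) (a : Instance n b) (w : Witness) where
  open Verifier V

  HaltsWithin : ℕ → Set
  HaltsWithin T = ∃[ s ] ∃[ t ] t ≤ T × program , input work n b a w ⇓ s ⟨ t ⟩

  -- V halts with the bit true at the head of register 0.
  Accepts : Set
  Accepts = ∃[ s ] ∃[ t ]
    program , input work n b a w ⇓ s ⟨ t ⟩ × List.head (lookup s fzero) ≡ just true

{-# OPTIONS --safe #-}

-- With N = 2 ^ b, a witness is a multiplier k. It is accepted if k mod N and the residues
-- y_i = k a_i mod N sum to less than N while the last residue alone is at least N / 2. A perfect
-- partition would, after multiplication by k, split these residues (with k mod N as an optional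
-- extra item) into two exactly equal halves, which is impossible.
--
-- For random a, write b = 2 m, M = 2 ^ m and take k = 1 + t M. The upper half of k (c M + y) mod N
-- is c + t y mod M, so its leading bits form the multiply-shift hash family, which is exactly
-- pairwise independent over distinct small t. By Chebyshev's inequality some t makes all residues
-- small, except for the top bit of the last one, as soon as the number of t exceeds 2 ^ (g n) by a
-- growing factor, where g = log n + O(1) leading bits are prescribed; this needs b of order n log n.

module Submission where

open import Defs
open import Data.Bool.Base as Bool using (Bool; true; false; if_then_else_; not; _xor_; _∧_; _∨_)
open import Data.Bool.Properties using () renaming (_≟_ to _≟ᵇ_)
open import Data.Empty using (⊥)
open import Data.Fin using (#_)
open import Data.Fin.Base as Fin using (Fin; toℕ)
open import Data.Fin.Properties using (toℕ<n)
open import Data.Fin.Subset using (Subset; ∁)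
open import Data.Integer.Base as ℤ using ()
import Data.Integer.Properties as ℤ
open import Data.List.Base as List using (List; []; _∷_; _++_; length; drop; take; replicate; head; _ʳ++_; upTo)
import Data.List.Properties as List
open import Data.List.Properties using (++-identityʳ; drop-drop; length-reverse; reverse-involutive)
open import Data.Maybe.Base using (just)
open import Data.Maybe.Properties using () renaming (≡-dec to ≡-decᴹ)
open import Data.Nat.Base
open import Data.Nat.Divisibility using (m∣m*n)
open import Data.Nat.DivMod hiding (result)
open import Data.Nat.Logarithm
open import Data.Nat.Properties
open import Data.Nat.Tactic.RingSolver using (solve-∀)
open import Data.Product.Base using (Σ-syntax; ∃-syntax; _×_; _,_; proj₁; proj₂)
open import Data.Rational.Base as ℚ using (ℚ; 0ℚ; 1ℚ; toℚᵘ; ↧ₙ_; mkℚ)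
import Data.Rational.Properties as ℚ
open import Data.Rational.Unnormalised.Base as ℚᵘ using (mkℚᵘ; *≤*)
import Data.Rational.Unnormalised.Properties as ℚᵘ
open import Data.Sum.Base using (_⊎_; inj₁; inj₂; [_,_]′)
open import Data.Unit.Base using (⊤)
open import Data.Vec.Base as Vec using (Vec; []; _∷_; lookup; _[_]≔_)
open import Function.Base using (_∘_; _⟨_⟩_)
open import Function.Bundles using (_⇔_; mk⇔; Equivalence)
open import Level using (0ℓ)
open import Relation.Binary.Definitions using (tri<; tri≈; tri>)
open import Relation.Binary.PropositionalEquality hiding (J; [_])
open import Relation.Nullary.Decidable using (Dec; yes; no; does; map′; _⊎-dec_)
open import Relation.Nullary.Negation.Core using (¬_; contradiction)
open import Relation.Unary using (Pred; Decidable)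

-- Running times of the verifier

-- The obstruction to a partition is size rather than parity, because a multiplier of this form
-- controls only the leading bits of the residues. With total below N, each of two equal halves
-- stays below N / 2, so neither has room for the last residue. The multiplier is itself one of the
-- summed items, so it must be small too. With t < 2 ^ h, where m = h + g, it is at most 2 ^ (m + h)
-- = N / 2 ^ g, the same bound as for an item whose g leading bits vanish. The range of t is also
-- what makes the hashing exact. The difference d of two values of t may be even, and multiplying by
-- it loses as many low bits as d has factors 2. Since 0 < d < 2 ^ h, only bits that the final shift
-- by h discards are affected. Exactness for one item passes to the n-fold product without any
-- accumulating error, so only the diagonal pairs contribute beyond the squared mean. Each t works
-- with probability 2 ^ -(g n), and h = e + g n gives 2 ^ e expected successes. All probabilities
-- are kept as counts of instances in ℕ; rationals enter only in the last estimate.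

record Runs {k} (c : Program k) (s s′ : Store k) (T : ℕ) : Set where
  constructor runs
  field
    {steps} : ℕ
    bound   : steps ≤ T
    run     : c , s ⇓ s′ ⟨ steps ⟩

infixr 5 _⟫_
_⟫_ : ∀ {k} {c d : Program k} {s s′ s″ T U} →
      Runs c s s′ T → Runs d s′ s″ U → Runs (c ⨾ d) s s″ (T + U)
runs t≤T p ⟫ runs u≤U q = runs (+-mono-≤ t≤T u≤U) (⇓-seq p q)

relax : ∀ {k} {c : Program k} {s s′ T U} → T ≤ U → Runs c s s′ T → Runs c s s′ U
relax T≤U (runs t≤T p) = runs (≤-trans t≤T T≤U) p

while-[] : ∀ {k} {x : Fin k} {c s} → lookup s x ≡ [] → Runs (while x c) s s 1
while-[] e = runs ≤-refl (⇓-while-[] e)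

while-∷ : ∀ {k} {x : Fin k} {c s s′ s″ v l T U} → lookup s x ≡ v ∷ l →
          Runs c s s′ T → Runs (while x c) s′ s″ U → Runs (while x c) s s″ (suc (T + U))
while-∷ e (runs t≤T p) (runs u≤U q) = runs (s≤s (+-mono-≤ t≤T u≤U)) (⇓-while-∷ e p q)

choose : {A : Set} → List Bool → A → A → A → A
choose []          x y z = x
choose (false ∷ _) x y z = y
choose (true ∷ _)  x y z = z

LoopFree : ∀ {k} → Program k → Set
LoopFree (c ⨾ d)        = LoopFree c × LoopFree d
LoopFree (case _ c d e) = LoopFree c × LoopFree d × LoopFree e
LoopFree (while _ _)    = ⊥
LoopFree _              = ⊤

result : ∀ {k} → Program k → Store k → Store k
result (x ≔ y)        s = s [ x ]≔ lookup s y
result (push x v)     s = s [ x ]≔ (v ∷ lookup s x)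
result (pop x)        s = s [ x ]≔ drop 1 (lookup s x)
result (c ⨾ d)        s = result d (result c s)
result (case x c d e) s = choose (lookup s x) (result c s) (result d s) (result e s)
-- A filler value; `LoopFree` excludes loops.
result (while _ _)    s = s

cost : ∀ {k} → Program k → ℕ
cost (c ⨾ d)        = cost c + cost d
cost (case _ c d e) = suc (cost c ⊔ (cost d ⊔ cost e))
cost _              = 1

-- Loop-free code is run by evaluation. For a concrete program `LoopFree c` reduces to a product of
-- unit types, which Agda fills in, so a whole block costs one call.
straight : ∀ {k} (c : Program k) {s} {_ : LoopFree c} → Runs c s (result c s) (cost c)
straight (x ≔ y)    = runs ≤-refl ⇓-copy
straight (push x v) = runs ≤-refl ⇓-push
straight (pop x)    = runs ≤-refl ⇓-pop
straight (c ⨾ d) {_} {p , q} = straight c {_} {p} ⟫ straight d {_} {q}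
straight (case x c d e) {s} {p , q , r} with lookup s x in eq
... | []        = let runs t≤T u = straight c {s} {p} in
                  runs (s≤s (≤-trans t≤T (m≤m⊔n _ _))) (⇓-case-[] eq u)
... | false ∷ _ = let runs t≤T u = straight d {s} {q} in
                  runs (s≤s (≤-trans t≤T (≤-trans (m≤m⊔n _ _) (m≤n⊔m (cost c) _)))) (⇓-case-false eq u)
... | true ∷ _  = let runs t≤T u = straight e {s} {r} in
                  runs (s≤s (≤-trans t≤T (≤-trans (m≤n⊔m (cost d) _) (m≤n⊔m (cost c) _)))) (⇓-case-true eq u)

-- The verifier as a program

-- The first four registers hold the input; the answer replaces the counter #n.
#n #b #a #w #acc #p #v #x #y #cnt #r #c #ov : Fin 13
#n = # 0 ; #b = # 1 ; #a = # 2 ; #w = # 3 ; #acc = # 4 ; #p = # 5 ; #v = # 6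
#x = # 7 ; #y = # 8 ; #cnt = # 9 ; #r = # 10 ; #c = # 11 ; #ov = # 12

skip : Program 13
skip = #x ≔ #x

countBit : Fin 13 → Program 13
countBit x = case x skip skip (push #c true) ⨾ pop x

-- #c holds 0 to 3 bits; emit splits their number into a digit and a carry.
emit : Program 13
emit = case #c (push #r false) one one
  where
  three two one : Program 13
  three = push #r true
  two   = pop #c ⨾ case #c (push #r false ⨾ push #c true) three three
  one   = pop #c ⨾ case #c (push #r true) two two

-- Numbers are stored least significant bit first, so the digits of a sum pile up reversed in `#r`
-- and `revStep` turns them round. `mul` is Horner's rule along the witness, most significant bit
-- first. An exhausted `#cnt` doubles as the empty string that clears other registers.
addStep revStep add mulStep mul mainStep main : Program 13
addStep = pop #cnt ⨾ countBit #x ⨾ countBit #y ⨾ emit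
revStep = case #r skip (push #x false) (push #x true) ⨾ pop #r
add = #cnt ≔ #b ⨾ while #cnt addStep ⨾ (#x ≔ #cnt ⨾ #y ≔ #cnt) ⨾ while #r revStep
-- The whole unread encoding goes into `#y`: `add` consults only its first b digits, so the current
-- item need not be cut out.
mulStep = (case #v skip skip (#y ≔ #a) ⨾ pop #v ⨾ #x ≔ #p ⨾ push #x false) ⨾ add
          ⨾ (#p ≔ #x ⨾ #x ≔ #cnt ⨾ #c ≔ #cnt)
mul = (#p ≔ #cnt ⨾ #v ≔ #w) ⨾ while #v mulStep
mainStep = pop #n ⨾ mul ⨾ (#x ≔ #acc ⨾ #y ≔ #p) ⨾ add
           ⨾ (#acc ≔ #x ⨾ #x ≔ #cnt ⨾ case #c skip skip (push #ov true) ⨾ #c ≔ #cnt ⨾ #cnt ≔ #b)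
           ⨾ while #cnt (pop #cnt ⨾ pop #a)
-- The running total starts from the multiplier, the optional extra item. After the loop `#n` is
-- empty, which means rejection; only without recorded overflow does it receive the last product,
-- top bit first.
main = #r ≔ #w ⨾ while #r revStep ⨾ (#acc ≔ #x ⨾ #x ≔ #cnt) ⨾ while #n mainStep ⨾ #r ≔ #p ⨾ while #r revStep
       ⨾ case #ov (#n ≔ #x) skip skip

verifier : Verifier
verifier = record { work = 9 ; program = main }

-- A functional model of the program, and the cost of running it

store : (n b a w acc p v x y cnt r c ov : List Bool) → Store 13
store n b a w acc p v x y cnt r c ov =
  n ∷ b ∷ a ∷ w ∷ acc ∷ p ∷ v ∷ x ∷ y ∷ cnt ∷ r ∷ c ∷ ov ∷ []

digit : List Bool → Bool
digit []      = false
digit (v ∷ _) = v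

carried : Bool → List Bool
carried false = []
carried true  = true ∷ []

majority : Bool → Bool → Bool → Bool
majority x y c = if c then x ∨ y else x ∧ y

sumBits : ℕ → List Bool → List Bool → Bool → List Bool
sumBits zero    xs ys c = []
sumBits (suc k) xs ys c = (c xor digit xs xor digit ys) ∷
  sumBits k (drop 1 xs) (drop 1 ys) (majority (digit xs) (digit ys) c)

carryOut : ℕ → List Bool → List Bool → Bool → Bool
carryOut zero    xs ys c = c
carryOut (suc k) xs ys c =
  carryOut k (drop 1 xs) (drop 1 ys) (majority (digit xs) (digit ys) c)

mulBits : ℕ → List Bool → List Bool → List Bool → List Bool
mulBits b a []      p = p
mulBits b a (v ∷ w) p = mulBits b a w (sumBits b (false ∷ p) (if v then a else []) false)

flag : Bool → List Bool → List Bool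
flag v ov = if v then true ∷ ov else ov

verdict : (p ov : List Bool) → List Bool
verdict p []      = p ʳ++ []
verdict p (_ ∷ _) = []

-- The model of the main loop. Each round overwrites `p`, so the verdict sees the product of the
-- last item only, whereas a nonempty `ov` stays nonempty.
answer : ℕ → ℕ → (a w acc p ov : List Bool) → List Bool
answer zero    b a w acc p ov = verdict p ov
answer (suc n) b a w acc p ov =
  let q = mulBits b a w [] in
  answer n b (drop b a) w (sumBits b acc q false) q (flag (carryOut b acc q false) ov)

length-sumBits : ∀ k xs ys c → length (sumBits k xs ys c) ≡ k
length-sumBits zero    xs ys c = refl
length-sumBits (suc k) xs ys c = cong suc (length-sumBits k _ _ _)

-- Splitting on both leading digits and the carry fixes every branch taken, so that `result`
-- computes to the stated store in each case. An exhausted summand counts as digit zero.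
addStep-runs : ∀ {n b a w acc p v u cnt r ov} xs ys c →
  Runs addStep (store n b a w acc p v xs ys (u ∷ cnt) r (carried c) ov)
    (store n b a w acc p v (drop 1 xs) (drop 1 ys) cnt ((c xor digit xs xor digit ys) ∷ r)
      (carried (majority (digit xs) (digit ys) c)) ov) 14
addStep-runs []          []          false = straight addStep
addStep-runs []          []          true  = straight addStep
addStep-runs []          (false ∷ _) false = straight addStep
addStep-runs []          (false ∷ _) true  = straight addStep
addStep-runs []          (true ∷ _)  false = straight addStep
addStep-runs []          (true ∷ _)  true  = straight addStep
addStep-runs (false ∷ _) []          false = straight addStep
addStep-runs (false ∷ _) []          true  = straight addStep
addStep-runs (false ∷ _) (false ∷ _) false = straight addStep
addStep-runs (false ∷ _) (false ∷ _) true  = straight addStep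
addStep-runs (false ∷ _) (true ∷ _)  false = straight addStep
addStep-runs (false ∷ _) (true ∷ _)  true  = straight addStep
addStep-runs (true ∷ _)  []          false = straight addStep
addStep-runs (true ∷ _)  []          true  = straight addStep
addStep-runs (true ∷ _)  (false ∷ _) false = straight addStep
addStep-runs (true ∷ _)  (false ∷ _) true  = straight addStep
addStep-runs (true ∷ _)  (true ∷ _)  false = straight addStep
addStep-runs (true ∷ _)  (true ∷ _)  true  = straight addStep

addLoop-runs : ∀ {n b a w acc p v ov} k xs ys {r} c →
  Runs (while #cnt addStep) (store n b a w acc p v xs ys (replicate k true) r (carried c) ov)
    (store n b a w acc p v (drop k xs) (drop k ys) [] (sumBits k xs ys c ʳ++ r)
      (carried (carryOut k xs ys c)) ov) (k * 15 + 1)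
addLoop-runs zero    xs ys c = while-[] refl
addLoop-runs (suc k) xs ys c rewrite sym (drop-drop 1 k xs) | sym (drop-drop 1 k ys) =
  while-∷ refl (addStep-runs xs ys c) (addLoop-runs k (drop 1 xs) (drop 1 ys) _)

revStep-runs : ∀ {n b a w acc p v x y cnt c ov} u r →
  Runs revStep (store n b a w acc p v x y cnt (u ∷ r) c ov)
    (store n b a w acc p v (u ∷ x) y cnt r c ov) 3
revStep-runs false r = straight revStep
revStep-runs true  r = straight revStep

revLoop-runs : ∀ {n b a w acc p v x y cnt c ov} r →
  Runs (while #r revStep) (store n b a w acc p v x y cnt r c ov)
    (store n b a w acc p v (r ʳ++ x) y cnt [] c ov) (length r * 4 + 1)
revLoop-runs []      = while-[] refl
revLoop-runs (u ∷ r) = while-∷ refl (revStep-runs u r) (revLoop-runs r)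

dropLoop-runs : ∀ {n b w acc p v x y r c ov} k a →
  Runs (while #cnt (pop #cnt ⨾ pop #a)) (store n b a w acc p v x y (replicate k true) r c ov)
    (store n b (drop k a) w acc p v x y [] r c ov) (k * 3 + 1)
dropLoop-runs zero    a = while-[] refl
dropLoop-runs (suc k) a rewrite sym (drop-drop 1 k a) =
  while-∷ refl (straight (pop #cnt ⨾ pop #a)) (dropLoop-runs k (drop 1 a))

addTime mulStepTime : ℕ → ℕ
addTime b = b * 19 + 5
mulStepTime b = addTime b + 8

mulTime mainStepTime : (b l : ℕ) → ℕ
mulTime b l = l * suc (mulStepTime b) + 3
mainStepTime b l = mulTime b l + addTime b + b * 3 + 10

mainTime : (n b l : ℕ) → ℕ
mainTime n b l = n * suc (mainStepTime b l) + l * 4 + b * 4 + 9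

module _ {b : ℕ} where

  private
    bs : List Bool
    bs = replicate b true

  add-runs : ∀ {n a w acc p v ov} xs ys →
    Runs add (store n bs a w acc p v xs ys [] [] [] ov)
      (store n bs a w acc p v (sumBits b xs ys false) [] [] []
        (carried (carryOut b xs ys false)) ov) (addTime b)
  add-runs {n} {a} {w} {acc} {p} {v} {ov} xs ys =
    subst (λ z → Runs add (store n bs a w acc p v xs ys [] [] [] ov)
                          (store n bs a w acc p v z [] [] [] c ov) (addTime b))
      (reverse-involutive zs)
      (relax (≤-reflexive time)
        (straight (#cnt ≔ #b) ⟫ addLoop-runs b xs ys false
          ⟫ straight (#x ≔ #cnt ⨾ #y ≔ #cnt) ⟫ revLoop-runs (zs ʳ++ [])))
    where
    zs c : List Bool
    zs = sumBits b xs ys false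
    c  = carried (carryOut b xs ys false)
    regroup : ∀ b → 1 + (b * 15 + 1 + (2 + (b * 4 + 1))) ≡ b * 19 + 5
    regroup = solve-∀
    time : 1 + (b * 15 + 1 + (2 + (length (zs ʳ++ []) * 4 + 1))) ≡ addTime b
    time = trans (cong (λ l → 1 + (b * 15 + 1 + (2 + (l * 4 + 1))))
                   (trans (length-reverse zs) (length-sumBits b xs ys false)))
                 (regroup b)

  mulStep-runs : ∀ {n a w acc v ov} u p →
    Runs mulStep (store n bs a w acc p (u ∷ v) [] [] [] [] [] ov)
      (store n bs a w acc (sumBits b (false ∷ p) (if u then a else []) false) v [] [] [] [] [] ov)
      (mulStepTime b)
  mulStep-runs {a = a} u p =
    relax (≤-reflexive (time b)) (load u ⟫ add-runs (false ∷ p) _ ⟫ straight (#p ≔ #x ⨾ #x ≔ #cnt ⨾ #c ≔ #cnt))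
    where
    time : ∀ b → 5 + (addTime b + 3) ≡ mulStepTime b
    time b = +-comm 5 (addTime b + 3) ⟨ trans ⟩ +-assoc (addTime b) 3 5
    load : ∀ {n a w acc p v ov} u →
      Runs (case #v skip skip (#y ≔ #a) ⨾ pop #v ⨾ #x ≔ #p ⨾ push #x false)
        (store n bs a w acc p (u ∷ v) [] [] [] [] [] ov)
        (store n bs a w acc p v (false ∷ p) (if u then a else []) [] [] [] ov) 5
    load false = straight (case #v skip skip (#y ≔ #a) ⨾ pop #v ⨾ #x ≔ #p ⨾ push #x false)
    load true  = straight (case #v skip skip (#y ≔ #a) ⨾ pop #v ⨾ #x ≔ #p ⨾ push #x false)

  mulLoop-runs : ∀ {n a w acc ov} v p →
    Runs (while #v mulStep) (store n bs a w acc p v [] [] [] [] [] ov)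
      (store n bs a w acc (mulBits b a v p) [] [] [] [] [] [] ov) (length v * suc (mulStepTime b) + 1)
  mulLoop-runs []      p = while-[] refl
  mulLoop-runs (u ∷ v) p =
    relax (≤-reflexive (cong suc (sym (+-assoc (mulStepTime b) _ 1))))
      (while-∷ refl (mulStep-runs u p) (mulLoop-runs v _))

  mul-runs : ∀ {n a w acc p ov} →
    Runs mul (store n bs a w acc p [] [] [] [] [] [] ov)
      (store n bs a w acc (mulBits b a w []) [] [] [] [] [] [] ov) (mulTime b (length w))
  mul-runs {w = w} =
    relax (≤-reflexive (+-comm 2 (length w * _ + 1) ⟨ trans ⟩ +-assoc (length w * _) 1 2))
      (straight (#p ≔ #cnt ⨾ #v ≔ #w) ⟫ mulLoop-runs w [])

  mainStep-runs : ∀ {n a w acc p ov u} → let q = mulBits b a w [] in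
    Runs mainStep (store (u ∷ n) bs a w acc p [] [] [] [] [] [] ov)
      (store n bs (drop b a) w (sumBits b acc q false) q [] [] [] [] [] []
        (flag (carryOut b acc q false) ov)) (mainStepTime b (length w))
  mainStep-runs {a = a} {w} {acc} =
    relax (≤-reflexive (time (mulTime b (length w)) (addTime b) b))
      (straight (pop #n) ⟫ mul-runs ⟫ straight (#x ≔ #acc ⨾ #y ≔ #p) ⟫ add-runs acc _
        ⟫ store-sum _ ⟫ dropLoop-runs b a)
    where
    time : ∀ m s b → 1 + (m + (2 + (s + (6 + (b * 3 + 1))))) ≡ m + s + b * 3 + 10
    time = solve-∀
    finish : Program 13
    finish = #acc ≔ #x ⨾ #x ≔ #cnt ⨾ case #c skip skip (push #ov true) ⨾ #c ≔ #cnt ⨾ #cnt ≔ #b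
    store-sum : ∀ {n a w acc p x ov} v →
      Runs finish (store n bs a w acc p [] x [] [] [] (carried v) ov)
        (store n bs a w x p [] [] [] bs [] [] (flag v ov)) 6
    store-sum false = straight finish
    store-sum true  = straight finish

  length-mulBits : ∀ a w p → length p ≤ b → length (mulBits b a w p) ≤ b
  length-mulBits a []      p le = le
  length-mulBits a (v ∷ w) p le =
    length-mulBits a w _ (≤-reflexive (length-sumBits b (false ∷ p) (if v then a else []) false))

  -- The final registers stay abstract except for what the end of `main` needs: the verdict, and a
  -- length bound on `p′` that pays for its reversal.
  mainLoop-runs : ∀ n a w acc p ov → length p ≤ b →
    ∃[ a′ ] ∃[ acc′ ] ∃[ p′ ] ∃[ ov′ ] verdict p′ ov′ ≡ answer n b a w acc p ov × length p′ ≤ b ×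
      Runs (while #n mainStep) (store (replicate n true) bs a w acc p [] [] [] [] [] [] ov)
        (store [] bs a′ w acc′ p′ [] [] [] [] [] [] ov′) (n * suc (mainStepTime b (length w)) + 1)
  mainLoop-runs zero    a w acc p ov le = a , acc , p , ov , refl , le , while-[] refl
  mainLoop-runs (suc n) a w acc p ov le =
    let a′ , acc′ , p′ , ov′ , eq , le′ , loop = mainLoop-runs n _ w _ _ _ (length-mulBits a w [] z≤n)
    in  a′ , acc′ , p′ , ov′ , eq , le′ ,
        relax (≤-reflexive (cong suc (sym (+-assoc (mainStepTime b (length w)) _ 1))))
          (while-∷ refl mainStep-runs loop)

  main-runs : ∀ n a w → ∃[ s ] lookup s #n ≡ answer n b a w (w ʳ++ []) [] [] ×
    Runs main (store (replicate n true) bs a w [] [] [] [] [] [] [] [] []) s (mainTime n b (length w))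
  main-runs n a w =
    let a′ , acc′ , p′ , ov′ , eq , le , loop = mainLoop-runs n a w (w ʳ++ []) [] [] z≤n
        s , eq′ , end = decide ov′
    in  s , trans eq′ eq ,
        relax (time (n * suc (mainStepTime b (length w))) (length w) le)
          (straight (#r ≔ #w) ⟫ revLoop-runs w ⟫ straight (#acc ≔ #x ⨾ #x ≔ #cnt) ⟫ loop
            ⟫ straight (#r ≔ #p) ⟫ revLoop-runs p′ ⟫ end)
    where
    decide : ∀ {b a acc p} ov → ∃[ s ] lookup s #n ≡ verdict p ov ×
      Runs (case #ov (#n ≔ #x) skip skip) (store [] b a w acc p [] (p ʳ++ []) [] [] [] [] ov) s 2
    decide []         = _ , refl , straight (case #ov (#n ≔ #x) skip skip)
    decide (false ∷ _) = _ , refl , straight (case #ov (#n ≔ #x) skip skip)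
    decide (true ∷ _)  = _ , refl , straight (case #ov (#n ≔ #x) skip skip)
    regroup : ∀ m l k → 1 + (l * 4 + 1 + (2 + (m + 1 + (1 + (k * 4 + 1 + 2))))) ≡ m + l * 4 + k * 4 + 9
    regroup = solve-∀
    time : ∀ m l {k} → k ≤ b →
      1 + (l * 4 + 1 + (2 + (m + 1 + (1 + (k * 4 + 1 + 2))))) ≤ m + l * 4 + b * 4 + 9
    time m l {k} le rewrite regroup m l k = +-monoˡ-≤ 9 (+-monoʳ-≤ (m + l * 4) (*-monoˡ-≤ 4 le))

-- What the verifier computes

module _ (N : ℕ) .{{_ : NonZero N}} where

  +-cong-% : ∀ a a′ b b′ → a % N ≡ a′ % N → b % N ≡ b′ % N → (a + b) % N ≡ (a′ + b′) % N
  +-cong-% a a′ b b′ p q = trans (%-distribˡ-+ a b N)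
    (trans (cong₂ (λ x y → (x + y) % N) p q) (sym (%-distribˡ-+ a′ b′ N)))

  *-cong-% : ∀ a a′ b b′ → a % N ≡ a′ % N → b % N ≡ b′ % N → (a * b) % N ≡ (a′ * b′) % N
  *-cong-% a a′ b b′ p q = trans (%-distribˡ-* a b N)
    (trans (cong₂ (λ x y → (x * y) % N) p q) (sym (%-distribˡ-* a′ b′ N)))

  %-unique : ∀ {s c m} → s < N → s + c * N ≡ m → m % N ≡ s
  %-unique {s} {c} s<N refl = trans ([m+kn]%n≡m%n s c N) (m<n⇒m%n≡m s<N)

-- Binary numerals

bit : Bool → ℕ
bit v = if v then 1 else 0

val : List Bool → ℕ
val []      = 0
val (v ∷ l) = bit v + 2 * val l

bit+2*<2* : ∀ v {x y} → x < y → bit v + 2 * x < 2 * y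
bit+2*<2* v {x} x<y =
  ≤-trans (+-monoˡ-≤ _ (s≤s (bit≤1 v)))
    (≤-trans (≤-reflexive (sym (*-suc 2 x))) (*-monoʳ-≤ 2 x<y))
  where
  bit≤1 : ∀ v → bit v ≤ 1
  bit≤1 false = z≤n
  bit≤1 true  = ≤-refl

val<2^length : ∀ l → val l < 2 ^ length l
val<2^length []      = ≤-refl
val<2^length (v ∷ l) = bit+2*<2* v (val<2^length l)

-- Missing bits count as zeros, so take k is reduction modulo 2 ^ k, also for shorter lists.
val-sumBits-take : ∀ k xs ys c → val (sumBits k xs ys c) + bit (carryOut k xs ys c) * 2 ^ k ≡
                   val (take k xs) + val (take k ys) + bit c
val-sumBits-take zero    xs ys c = *-identityʳ (bit c)
val-sumBits-take (suc k) xs ys c = begin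
  z + 2 * s + o * (2 * 2 ^ k)              ≡⟨ regroup z s o (2 ^ k) ⟩
  z + 2 * (s + o * 2 ^ k)
    ≡⟨ cong (λ t → z + 2 * t) (val-sumBits-take k (drop 1 xs) (drop 1 ys) c′) ⟩
  z + 2 * (val (take k (drop 1 xs)) + val (take k (drop 1 ys)) + bit c′)
    ≡⟨ regroup′ z (val (take k (drop 1 xs))) (val (take k (drop 1 ys))) (bit c′) ⟩
  (z + 2 * bit c′) + (2 * val (take k (drop 1 xs)) + 2 * val (take k (drop 1 ys)))
    ≡⟨ cong (_+ (2 * val (take k (drop 1 xs)) + 2 * val (take k (drop 1 ys))))
         (fullAdder (digit xs) (digit ys) c) ⟩
  (bit (digit xs) + bit (digit ys) + bit c) + (2 * val (take k (drop 1 xs)) + 2 * val (take k (drop 1 ys)))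
    ≡⟨ regroup″ (bit (digit xs)) (bit (digit ys)) (bit c)
         (2 * val (take k (drop 1 xs))) (2 * val (take k (drop 1 ys))) ⟩
  (bit (digit xs) + 2 * val (take k (drop 1 xs))) + (bit (digit ys) + 2 * val (take k (drop 1 ys))) + bit c
    ≡⟨ cong₂ (λ s t → s + t + bit c) (uncons xs) (uncons ys) ⟩
  val (take (suc k) xs) + val (take (suc k) ys) + bit c ∎
  where
  open ≡-Reasoning
  c′ = majority (digit xs) (digit ys) c
  z  = bit (c xor digit xs xor digit ys)
  s  = val (sumBits k (drop 1 xs) (drop 1 ys) c′)
  o  = bit (carryOut k (drop 1 xs) (drop 1 ys) c′)
  regroup : ∀ z s o m → z + 2 * s + o * (2 * m) ≡ z + 2 * (s + o * m)
  regroup = solve-∀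
  regroup′ : ∀ z s t c → z + 2 * (s + t + c) ≡ (z + 2 * c) + (2 * s + 2 * t)
  regroup′ = solve-∀
  regroup″ : ∀ x y c s t → (x + y + c) + (s + t) ≡ (x + s) + (y + t) + c
  regroup″ = solve-∀
  fullAdder : ∀ x y c → bit (c xor x xor y) + 2 * bit (majority x y c) ≡ bit x + bit y + bit c
  fullAdder false false false = refl
  fullAdder false false true  = refl
  fullAdder false true  false = refl
  fullAdder false true  true  = refl
  fullAdder true  false false = refl
  fullAdder true  false true  = refl
  fullAdder true  true  false = refl
  fullAdder true  true  true  = refl
  uncons : ∀ xs → bit (digit xs) + 2 * val (take k (drop 1 xs)) ≡ val (take (suc k) xs)
  uncons (_ ∷ _) = refl
  uncons []      = cong (λ l → 2 * val l) (take-[] k)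
    where
    take-[] : ∀ k → take k [] ≡ []
    take-[] zero    = refl
    take-[] (suc _) = refl

length-binary : ∀ b m → length (binary b m) ≡ b
length-binary zero    m = refl
length-binary (suc b) m = cong suc (length-binary b (m / 2))

val-binary-++ : ∀ b {m} l → m < 2 ^ b → val (binary b m ++ l) ≡ m + val l * 2 ^ b
val-binary-++ zero    {zero} l _ = sym (*-identityʳ (val l))
val-binary-++ zero    {suc m} l (s≤s ())
val-binary-++ (suc b) {m} l m<2^ = begin
  bit (m % 2 ≡ᵇ 1) + 2 * val (binary b (m / 2) ++ l)
    ≡⟨ cong₂ (λ s t → s + 2 * t) (bit-parity (m % 2) (m%n<n m 2))
         (val-binary-++ b l (m<n*o⇒m/o<n (subst (m <_) (*-comm 2 (2 ^ b)) m<2^))) ⟩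
  m % 2 + 2 * (m / 2 + val l * 2 ^ b)  ≡⟨ regroup (m % 2) (m / 2) (val l) (2 ^ b) ⟩
  (m % 2 + m / 2 * 2) + val l * (2 * 2 ^ b) ≡⟨ cong (_+ _) (sym (m≡m%n+[m/n]*n m 2)) ⟩
  m + val l * (2 * 2 ^ b) ∎
  where
  open ≡-Reasoning
  regroup : ∀ r q l t → r + 2 * (q + l * t) ≡ (r + q * 2) + l * (2 * t)
  regroup = solve-∀
  bit-parity : ∀ r → r < 2 → bit (r ≡ᵇ 1) ≡ r
  bit-parity 0 _ = refl
  bit-parity 1 _ = refl
  bit-parity (suc (suc r)) (s≤s (s≤s ()))

drop-length-++ : ∀ {A : Set} b (l k : List A) → length l ≡ b → drop b (l ++ k) ≡ k
drop-length-++ _ []      k refl = refl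
drop-length-++ _ (_ ∷ l) k refl = drop-length-++ _ l k refl

head-ʳ++ : ∀ (p q : List Bool) k → length p ≡ suc k →
           head (p ʳ++ q) ≡ just true ⇔ 2 ^ k ≤ val p
head-ʳ++ (true  ∷ []) q zero refl = mk⇔ (λ _ → ≤-refl) (λ _ → refl)
head-ʳ++ (false ∷ []) q zero refl = mk⇔ (λ ()) (λ ())
head-ʳ++ (v ∷ u ∷ p) q (suc k) eq = mk⇔
  (λ h → ≤-trans (*-monoʳ-≤ 2 (to h)) (m≤n+m _ (bit v)))
  (λ le → from (s≤s⁻¹ (*-cancelˡ-< 2 _ _ (≤-<-trans le (bit+2*<2* v ≤-refl)))))
  where open Equivalence (head-ʳ++ (u ∷ p) (v ∷ q) k (suc-injective eq))

-- Doubling the value avoids the exponent b - 1, so that b = 0 is covered as well: there both sides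
-- fail.
HeadIsTop : ℕ → List Bool → Set
HeadIsTop b p = head (p ʳ++ []) ≡ just true ⇔ 2 ^ b ≤ 2 * val p

headIsTop : ∀ b p → length p ≡ b → HeadIsTop b p
headIsTop zero    [] _ = mk⇔ (λ ()) (λ ())
headIsTop (suc b) p eq = mk⇔ (λ h → *-monoʳ-≤ 2 (to h)) (λ le → from (*-cancelˡ-≤ 2 le))
  where open Equivalence (head-ʳ++ p [] b eq)

-- Subset sums and partitions

-- The default plays the part of register `#p`, which still holds the previous product when the
-- items run out.
finalOr : ∀ {n} → ℕ → Vec ℕ n → ℕ
finalOr y []       = y
finalOr _ (y ∷ ys) = finalOr y ys

subsetSum : ∀ {n} → Subset n → Vec ℕ n → ℕ
subsetSum []      []       = 0
subsetSum (s ∷ S) (x ∷ xs) = (if s then x else 0) + subsetSum S xs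

subsetSum-∁ : ∀ {n} (S : Subset n) xs → subsetSum S xs + subsetSum (∁ S) xs ≡ Vec.sum xs
subsetSum-∁ []      []       = refl
subsetSum-∁ (s ∷ S) (x ∷ xs) = begin
  ((if s then x else 0) + p) + ((if not s then x else 0) + q)
    ≡⟨ regroup (if s then x else 0) p (if not s then x else 0) q ⟩
  ((if s then x else 0) + (if not s then x else 0)) + (p + q)
    ≡⟨ cong₂ _+_ (split s) (subsetSum-∁ S xs) ⟩
  x + Vec.sum xs ∎
  where
  open ≡-Reasoning
  p = subsetSum S xs
  q = subsetSum (∁ S) xs
  regroup : ∀ a b c d → (a + b) + (c + d) ≡ (a + c) + (b + d)
  regroup = solve-∀
  split : ∀ s → (if s then x else 0) + (if not s then x else 0) ≡ x
  split true  = +-identityʳ x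
  split false = refl

finalOr≤subsetSum : ∀ {n} (S : Subset (suc n)) xs y →
  finalOr y xs ≤ subsetSum S xs ⊎ finalOr y xs ≤ subsetSum (∁ S) xs
finalOr≤subsetSum (true  ∷ []) (x ∷ []) y = inj₁ (m≤m+n x 0)
finalOr≤subsetSum (false ∷ []) (x ∷ []) y = inj₂ (m≤m+n x 0)
finalOr≤subsetSum (s ∷ S@(_ ∷ _)) (x ∷ xs) y with finalOr≤subsetSum S xs x
... | inj₁ le = inj₁ (≤-trans le (m≤n+m _ _))
... | inj₂ le = inj₂ (≤-trans le (m≤n+m _ _))

sumOver-integers : ∀ {M n} (S : Subset n) (a : Vec (Fin M) n) →
                   sumOver S (integers a) ≡ ℤ.+ subsetSum S (Vec.map toℕ a)
sumOver-integers []          []      = refl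
sumOver-integers (true  ∷ S) (x ∷ a) = cong (ℤ._+_ (ℤ.+ toℕ x)) (sumOver-integers S a)
sumOver-integers (false ∷ S) (x ∷ a) = trans (ℤ.+-identityˡ _) (sumOver-integers S a)

-- A subtraction-free form: at most one unit, put on the lighter side, balances the partition.
-- Multiplied by `k`, this unit becomes the optional item `k % 2 ^ b`.
∣-∣≤1 : ∀ p q → ℤ.∣ ℤ.+ p ℤ.- ℤ.+ q ∣ ≤ 1 → ∃[ e ] ∃[ f ] p + e ≡ q + f × e + f ≤ 1
∣-∣≤1 p q le rewrite ℤ.m-n≡m⊖n p q = go p q le
  where
  go : ∀ p q → ℤ.∣ p ℤ.⊖ q ∣ ≤ 1 → ∃[ e ] ∃[ f ] p + e ≡ q + f × e + f ≤ 1
  go zero    zero    le = 0 , 0 , refl , z≤n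
  go zero    (suc q) le = suc q , 0 , sym (+-identityʳ _) , subst (_≤ 1) (sym (+-identityʳ (suc q))) le
  go (suc p) zero    le = 0 , suc p , +-identityʳ _ , le
  go (suc p) (suc q) le rewrite ℤ.[1+m]⊖[1+n]≡m⊖n p q =
    let e , f , eq , le′ = go p q le in e , f , cong suc eq , le′

val-sumBits<2^ : ∀ k xs ys c → val (sumBits k xs ys c) < 2 ^ k
val-sumBits<2^ k xs ys c = subst (λ l → val (sumBits k xs ys c) < 2 ^ l) (length-sumBits k xs ys c)
  (val<2^length (sumBits k xs ys c))

-- Arithmetic modulo 2 ^ b and the acceptance condition

module _ (b : ℕ) where

  private instance
    2^b-nonZero : NonZero (2 ^ b)
    2^b-nonZero = m^n≢0 2 b

  val-take : ∀ xs → val (take b xs) ≡ val xs % 2 ^ b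
  val-take xs = sym (%-unique (2 ^ b) {c = val (drop b xs)} (bound b xs) (split b xs))
    where
    bound : ∀ k xs → val (take k xs) < 2 ^ k
    bound zero    xs       = ≤-refl
    bound (suc k) []       = m^n>0 2 (suc k)
    bound (suc k) (v ∷ xs) = bit+2*<2* v (bound k xs)
    split : ∀ k xs → val (take k xs) + val (drop k xs) * 2 ^ k ≡ val xs
    split zero    xs       = *-identityʳ (val xs)
    split (suc k) []       = refl
    split (suc k) (v ∷ xs) = begin
      bit v + 2 * t + d * (2 * 2 ^ k) ≡⟨ regroup (bit v) t d (2 ^ k) ⟩
      bit v + 2 * (t + d * 2 ^ k)     ≡⟨ cong (λ s → bit v + 2 * s) (split k xs) ⟩
      bit v + 2 * val xs ∎
      where
      open ≡-Reasoning
      t = val (take k xs)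
      d = val (drop k xs)
      regroup : ∀ v t d m → v + 2 * t + d * (2 * m) ≡ v + 2 * (t + d * m)
      regroup = solve-∀

  val-sumBits-carry : ∀ xs ys → val (sumBits b xs ys false) + bit (carryOut b xs ys false) * 2 ^ b ≡
                      val xs % 2 ^ b + val ys % 2 ^ b
  val-sumBits-carry xs ys =
    trans (val-sumBits-take b xs ys false)
      (trans (+-identityʳ _) (cong₂ _+_ (val-take xs) (val-take ys)))

  val-sumBits : ∀ xs ys → val (sumBits b xs ys false) ≡ (val xs + val ys) % 2 ^ b
  val-sumBits xs ys = sym (trans (%-distribˡ-+ (val xs) (val ys) (2 ^ b))
    (%-unique (2 ^ b) {c = bit (carryOut b xs ys false)}
      (val-sumBits<2^ b xs ys false) (val-sumBits-carry xs ys)))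

  -- The invariant of Horner's rule: `l` is the part of the multiplier read so far, turned least
  -- significant bit first.
  val-mulBits : ∀ a w {p l} → val p ≡ (val l * val a) % 2 ^ b →
                val (mulBits b a w p) ≡ (val (w ʳ++ l) * val a) % 2 ^ b
  val-mulBits a []      eq = eq
  val-mulBits a (v ∷ w) {p} {l} eq = val-mulBits a w {l = v ∷ l} (begin
    val (sumBits b (false ∷ p) (if v then a else []) false)
      ≡⟨ val-sumBits (false ∷ p) (if v then a else []) ⟩
    (2 * val p + val (if v then a else [])) % 2 ^ b
      ≡⟨ cong₂ (λ s t → (2 * s + t) % 2 ^ b) eq (val-if v) ⟩
    (2 * ((val l * val a) % 2 ^ b) + bit v * val a) % 2 ^ b
      ≡⟨ +-cong-% (2 ^ b) (2 * (la % 2 ^ b)) (2 * la) (bit v * val a) (bit v * val a)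
           (*-cong-% (2 ^ b) 2 2 (la % 2 ^ b) la refl (m%n%n≡m%n la (2 ^ b))) refl ⟩
    (2 * (val l * val a) + bit v * val a) % 2 ^ b
      ≡⟨ cong (_% 2 ^ b) (regroup (val l) (val a) (bit v)) ⟩
    ((bit v + 2 * val l) * val a) % 2 ^ b ∎)
    where
    open ≡-Reasoning
    la = val l * val a
    regroup : ∀ l a v → 2 * (l * a) + v * a ≡ (v + 2 * l) * a
    regroup = solve-∀
    val-if : ∀ v → val (if v then a else []) ≡ bit v * val a
    val-if false = refl
    val-if true  = sym (+-identityʳ (val a))

  residues : ∀ {n} (k : ℕ) → Instance n b → Vec ℕ n
  residues k = Vec.map (λ x → (k * toℕ x) % 2 ^ b)

  module _ (w : List Bool) where

    private
      M k : ℕ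
      M = 2 ^ b
      k = val (w ʳ++ [])

    headIsTop-mulBits : ∀ a w → HeadIsTop b (mulBits b a w [])
    -- The empty witness leaves a product with no digits at all instead of b of them; both sides
    -- fail.
    headIsTop-mulBits a []      = mk⇔ (λ ()) (λ le → contradiction (≤-trans (m^n>0 2 b) le) λ ())
    headIsTop-mulBits a (v ∷ w) = headIsTop b (mulBits b a (v ∷ w) [])
      (length-mul w (sumBits b (false ∷ []) (if v then a else []) false)
        (length-sumBits b (false ∷ []) (if v then a else []) false))
      where
      length-mul : ∀ w p → length p ≡ b → length (mulBits b a w p) ≡ b
      length-mul []      p eq = eq
      length-mul (v ∷ w) p eq = length-mul w _ (length-sumBits b (false ∷ p) (if v then a else []) false)

    -- Without a carry the truncated sum is the true one. With a carry the true total has already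
    -- reached `M`, and later items cannot lower it. Hence the overflow flags decide whether the
    -- untruncated total stays below `M`.
    carry-step : ∀ c {ov s r y t} → s < M → s + bit c * M ≡ r + y →
      (flag c ov ≡ [] × s % M + t < M) ⇔ (ov ≡ [] × r + (y + t) < M)
    carry-step false {ov} {s} {r} {y} {t} s<M eq = mk⇔ (subst Bounded sum) (subst Bounded (sym sum))
      where
      Bounded : ℕ → Set
      Bounded n = ov ≡ [] × n < M
      sum : s % M + t ≡ r + (y + t)
      sum = begin
        s % M + t   ≡⟨ cong (_+ t) (m<n⇒m%n≡m s<M) ⟩
        s + t       ≡⟨ cong (_+ t) (trans (sym (+-identityʳ s)) eq) ⟩
        r + y + t   ≡⟨ +-assoc r y t ⟩
        r + (y + t) ∎
        where open ≡-Reasoning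
    carry-step true {s = s} {r} {y} {t} s<M eq = mk⇔ (λ ()) (λ (_ , lt) → contradiction lt (≤⇒≯ M≤))
      where
      M≤ : M ≤ r + (y + t)
      M≤ = begin
        M           ≡⟨ *-identityˡ M ⟨
        1 * M       ≤⟨ m≤n+m (1 * M) s ⟩
        s + 1 * M   ≡⟨ eq ⟩
        r + y       ≤⟨ m≤m+n (r + y) t ⟩
        r + y + t   ≡⟨ +-assoc r y t ⟩
        r + (y + t) ∎
        where open ≤-Reasoning

    answer-accepts : ∀ {n} (a : Instance n b) acc p ov → HeadIsTop b p →
      head (answer n b (encode n b a) w acc p ov) ≡ just true ⇔
      (ov ≡ [] × val acc % M + Vec.sum (residues k a) < M × M ≤ 2 * finalOr (val p) (residues k a))
    answer-accepts [] acc p [] top = mk⇔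
      (λ h → refl , subst (_< M) (sym (+-identityʳ _)) (m%n<n (val acc) M) , to h)
      (λ (_ , _ , le) → from le)
      where open Equivalence top
    answer-accepts [] acc p (_ ∷ _) top = mk⇔ (λ ()) (λ ())
    answer-accepts {suc n} (x ∷ a) acc p ov top =
      mk⇔ (λ h → let o , lt , le = to h ; o′ , lt′ = sum.to (o , lt) in
                 o′ , lt′ , subst (λ y → M ≤ 2 * finalOr y rs) val-q le)
          (λ (o , lt , le) → let o′ , lt′ = sum.from (o , lt) in
                 from (o′ , lt′ , subst (λ y → M ≤ 2 * finalOr y rs) (sym val-q) le))
      where
      l q s : List Bool
      l = encode (suc n) b (x ∷ a)
      q = mulBits b l w []
      s = sumBits b acc q false
      c : Bool
      c = carryOut b acc q false
      rs : Vec ℕ n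
      rs = residues k a
      y : ℕ
      y = (k * toℕ x) % M
      val-q : val q ≡ y
      -- `l` encodes all remaining items, but those after `x` contribute multiples of `M`.
      val-q = trans (val-mulBits l w {[]} {[]} (sym (m<n⇒m%n≡m (m^n>0 2 b))))
        (*-cong-% M k k (val l) (toℕ x) refl (trans (cong (_% M) (val-binary-++ b (encode n b a) (toℕ<n x)))
                            ([m+kn]%n≡m%n (toℕ x) (val (encode n b a)) M)))
      open Equivalence
        (subst (λ l′ → head (answer n b l′ w s q (flag c ov)) ≡ just true ⇔
                       (flag c ov ≡ [] × val s % M + Vec.sum rs < M × M ≤ 2 * finalOr (val q) rs))
          (sym (drop-length-++ b (binary b (toℕ x)) (encode n b a) (length-binary b (toℕ x))))
          (answer-accepts a s q (flag c ov) (headIsTop-mulBits l w)))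
      module sum = Equivalence (carry-step c {r = val acc % M} {y} (val-sumBits<2^ b acc q false)
        (trans (val-sumBits-carry acc q)
          (cong (val acc % M +_) (trans (cong (_% M) val-q) (m%n%n≡m%n (k * toℕ x) M)))))

  subsetSum-residues : ∀ {n} k (S : Subset n) (a : Instance n b) →
    (k * subsetSum S (Vec.map toℕ a)) % 2 ^ b ≡ subsetSum S (residues k a) % 2 ^ b
  subsetSum-residues k []          []      = cong (_% 2 ^ b) (*-zeroʳ k)
  subsetSum-residues k (false ∷ S) (x ∷ a) = subsetSum-residues k S a
  subsetSum-residues k (true  ∷ S) (x ∷ a) =
    trans (cong (_% 2 ^ b) (*-distribˡ-+ k (toℕ x) _))
      (+-cong-% (2 ^ b) (k * toℕ x) ((k * toℕ x) % 2 ^ b)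
        (k * subsetSum S (Vec.map toℕ a)) (subsetSum S (residues k a))
        (sym (m%n%n≡m%n (k * toℕ x) (2 ^ b))) (subsetSum-residues k S a))

  -- Multiplying a partition of discrepancy at most 1 by k turns it into a partition of the
  -- residues, with k % 2 ^ b as an optional extra item. It is exact, because everything sums to less
  -- than 2 ^ b; but the last residue alone exceeds half of that.
  no-perfectPartition : ∀ {n} k (a : Instance (suc n) b) y → HasPerfectPartition (integers a) →
    k % 2 ^ b + Vec.sum (residues k a) < 2 ^ b → 2 * finalOr y (residues k a) < 2 ^ b
  no-perfectPartition k a y (S , le) lt
    rewrite sumOver-integers S a | sumOver-integers (∁ S) a
    with e , f , eq , e+f≤1 ← ∣-∣≤1 (subsetSum S (Vec.map toℕ a)) (subsetSum (∁ S) (Vec.map toℕ a)) le =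
    [ half (subsetSum-∁ S rs) (m+n≤o⇒n≤o e e+f≤1) balance ,
      half (trans (+-comm q p) (subsetSum-∁ S rs)) (m+n≤o⇒m≤o e e+f≤1) (sym balance) ]′
    (finalOr≤subsetSum S rs y)
    where
    open ≤-Reasoning
    M r p q z : ℕ
    rs : Vec ℕ _
    M  = 2 ^ b
    r  = k % M
    rs = residues k a
    p  = subsetSum S rs
    q  = subsetSum (∁ S) rs
    z  = finalOr y rs
    P′ Q′ : ℕ
    P′ = subsetSum S (Vec.map toℕ a)
    Q′ = subsetSum (∁ S) (Vec.map toℕ a)
    small : ∀ {s e} → s ≤ Vec.sum rs → e ≤ 1 → s + r * e < M
    small {s} {e} s≤ e≤1 = begin-strict
      s + r * e         ≤⟨ +-mono-≤ s≤ (≤-trans (*-monoʳ-≤ r e≤1) (≤-reflexive (*-identityʳ r))) ⟩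
      Vec.sum rs + r    ≡⟨ +-comm (Vec.sum rs) r ⟩
      r + Vec.sum rs    <⟨ lt ⟩
      M                 ∎
    p≤ : p ≤ Vec.sum rs
    p≤ = ≤-trans (m≤m+n p q) (≤-reflexive (subsetSum-∁ S rs))
    q≤ : q ≤ Vec.sum rs
    q≤ = ≤-trans (m≤n+m q p) (≤-reflexive (subsetSum-∁ S rs))
    scale : ∀ T e → (k * (subsetSum T (Vec.map toℕ a) + e)) % M ≡ (subsetSum T rs + r * e) % M
    scale T e = trans (cong (_% M) (*-distribˡ-+ k _ e))
      (+-cong-% M (k * subsetSum T (Vec.map toℕ a)) (subsetSum T rs) (k * e) (r * e)
        (subsetSum-residues k T a) (*-cong-% M k r e e (sym (m%n%n≡m%n k M)) refl))
    balance : p + r * e ≡ q + r * f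
    balance = begin-equality
      p + r * e             ≡⟨ m<n⇒m%n≡m (small p≤ (m+n≤o⇒m≤o e e+f≤1)) ⟨
      (p + r * e) % M       ≡⟨ scale S e ⟨
      (k * (P′ + e)) % M     ≡⟨ cong (λ t → (k * t) % M) eq ⟩
      (k * (Q′ + f)) % M     ≡⟨ scale (∁ S) f ⟩
      (q + r * f) % M       ≡⟨ m<n⇒m%n≡m (small q≤ (m+n≤o⇒n≤o e e+f≤1)) ⟩
      q + r * f             ∎
    half : ∀ {p q e f} → p + q ≡ Vec.sum rs → f ≤ 1 → p + r * e ≡ q + r * f → z ≤ p → 2 * z < M
    half {p} {q} {e} {f} total f≤1 eq z≤p = begin-strict
      2 * z            ≡⟨ cong (z +_) (+-identityʳ z) ⟩
      z + z            ≤⟨ +-mono-≤ z≤p z≤p ⟩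
      p + p            ≤⟨ +-monoʳ-≤ p (≤-trans (m≤m+n p (r * e)) (≤-reflexive eq)) ⟩
      p + (q + r * f)  ≡⟨ +-assoc p q (r * f) ⟨
      p + q + r * f    <⟨ small (≤-reflexive total) f≤1 ⟩
      M                ∎

-- The second moment method

private variable
  I J : Set

∑ : List I → (I → ℕ) → ℕ
∑ []       f = 0
∑ (x ∷ xs) f = f x + ∑ xs f

∑-cong : ∀ (xs : List I) {f g} → (∀ x → f x ≡ g x) → ∑ xs f ≡ ∑ xs g
∑-cong []       f≗g = refl
∑-cong (x ∷ xs) f≗g = cong₂ _+_ (f≗g x) (∑-cong xs f≗g)

∑-mono-≤ : ∀ (xs : List I) {f g} → (∀ x → f x ≤ g x) → ∑ xs f ≤ ∑ xs g
∑-mono-≤ []       f≤g = z≤n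
∑-mono-≤ (x ∷ xs) f≤g = +-mono-≤ (f≤g x) (∑-mono-≤ xs f≤g)

∑-const : ∀ (xs : List I) c → ∑ xs (λ _ → c) ≡ length xs * c
∑-const []       c = refl
∑-const (x ∷ xs) c = cong (c +_) (∑-const xs c)

∑-+ : ∀ (xs : List I) f g → ∑ xs (λ x → f x + g x) ≡ ∑ xs f + ∑ xs g
∑-+ []       f g = refl
∑-+ (x ∷ xs) f g rewrite ∑-+ xs f g = interchange (f x) (g x) (∑ xs f) (∑ xs g)
  where
  interchange : ∀ a b c d → a + b + (c + d) ≡ a + c + (b + d)
  interchange = solve-∀

∑-*ˡ : ∀ (xs : List I) c f → ∑ xs (λ x → c * f x) ≡ c * ∑ xs f
∑-*ˡ []       c f = sym (*-zeroʳ c)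
∑-*ˡ (x ∷ xs) c f rewrite ∑-*ˡ xs c f = sym (*-distribˡ-+ c (f x) (∑ xs f))

∑-swap : ∀ (xs : List I) (ys : List J) (f : I → J → ℕ) →
         ∑ xs (λ x → ∑ ys (f x)) ≡ ∑ ys (λ y → ∑ xs (λ x → f x y))
∑-swap []       ys f = sym (trans (∑-const ys 0) (*-zeroʳ (length ys)))
∑-swap (x ∷ xs) ys f rewrite ∑-swap xs ys f = sym (∑-+ ys (f x) _)

∑-++ : ∀ (xs ys : List I) f → ∑ (xs ++ ys) f ≡ ∑ xs f + ∑ ys f
∑-++ []       ys f = refl
∑-++ (x ∷ xs) ys f rewrite ∑-++ xs ys f = sym (+-assoc (f x) _ _)

∑-map : ∀ (xs : List I) (g : I → J) f → ∑ (List.map g xs) f ≡ ∑ xs (f ∘ g)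
∑-map []       g f = refl
∑-map (x ∷ xs) g f = cong (f (g x) +_) (∑-map xs g f)

-- Sums over initial segments of ℕ

∑< : ℕ → (ℕ → ℕ) → ℕ
∑< n = ∑ (upTo n)

∑<-suc : ∀ n f → ∑< (suc n) f ≡ f 0 + ∑< n (f ∘ suc)
∑<-suc n f = cong (f 0 +_)
  (trans (cong (λ l → ∑ l f) (sym (List.map-upTo suc n))) (∑-map (upTo n) suc f))

∑<-+ : ∀ m n f → ∑< (m + n) f ≡ ∑< m f + ∑< n (λ x → f (m + x))
∑<-+ zero    n f = refl
∑<-+ (suc m) n f rewrite ∑<-suc (m + n) f | ∑<-+ m n (f ∘ suc) | ∑<-suc m f =
  sym (+-assoc (f 0) _ _)

∑<-cong : ∀ n {f g} → (∀ x → x < n → f x ≡ g x) → ∑< n f ≡ ∑< n g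
∑<-cong zero    eq = refl
∑<-cong (suc n) {f} {g} eq rewrite ∑<-suc n f | ∑<-suc n g =
  cong₂ _+_ (eq 0 z<s) (∑<-cong n (λ x x<n → eq (suc x) (s<s x<n)))

∑<-const : ∀ n c → ∑< n (λ _ → c) ≡ n * c
∑<-const n c = trans (∑-const (upTo n) c) (cong (_* c) (List.length-upTo n))

∑<-* : ∀ m n f → ∑< (m * n) f ≡ ∑< m (λ c → ∑< n (λ x → f (c * n + x)))
∑<-* zero    n f = refl
∑<-* (suc m) n f
  rewrite ∑<-+ n (m * n) f | ∑<-* m n (λ x → f (n + x)) | ∑<-suc m (λ c → ∑< n (λ x → f (c * n + x))) =
  cong (∑< n f +_) (∑-cong (upTo m) (λ c → ∑-cong (upTo n) (λ x → cong f (sym (+-assoc n (c * n) x)))))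

∑<-2* : ∀ n f → ∑< (2 * n) f ≡ ∑< n (λ x → f (2 * x)) + ∑< n (λ x → f (1 + 2 * x))
∑<-2* n f = begin
  ∑< (2 * n) f                                              ≡⟨ cong (λ k → ∑< k f) (*-comm 2 n) ⟩
  ∑< (n * 2) f                                              ≡⟨ ∑<-* n 2 f ⟩
  ∑< n (λ x → f (x * 2 + 0) + (f (x * 2 + 1) + 0))
    ≡⟨ ∑-cong (upTo n) (λ x → cong₂ _+_ (cong f (even x))
         (trans (+-identityʳ _) (cong f (odd x)))) ⟩
  ∑< n (λ x → f (2 * x) + f (1 + 2 * x))                    ≡⟨ ∑-+ (upTo n) _ _ ⟩
  ∑< n (λ x → f (2 * x)) + ∑< n (λ x → f (1 + 2 * x))       ∎
  where
  open ≡-Reasoning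
  even : ∀ x → x * 2 + 0 ≡ 2 * x
  even = solve-∀
  odd : ∀ x → x * 2 + 1 ≡ 1 + 2 * x
  odd = solve-∀

[_≐_] : ℕ → ℕ → ℕ
[ x ≐ y ] = if x ≡ᵇ y then 1 else 0

∑<-[≐] : ∀ {n y} → y < n → ∑< n [_≐ y ] ≡ 1
∑<-[≐] {suc n} {zero}  _         = trans (∑<-suc n [_≐ 0 ]) (cong suc (trans (∑<-const n 0) (*-zeroʳ n)))
∑<-[≐] {suc n} {suc y} (s≤s y<n) = trans (∑<-suc n [_≐ suc y ]) (∑<-[≐] y<n)

-- Sums over a full period

Periodic : ℕ → (ℕ → ℕ) → Set
Periodic p f = ∀ x → f (p + x) ≡ f x

module _ {p f} (per : Periodic p f) where

  periodic-* : ∀ k x → f (k * p + x) ≡ f x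
  periodic-* zero    x = refl
  periodic-* (suc k) x = trans (cong f (+-assoc p (k * p) x)) (trans (per _) (periodic-* k x))

  -- Moving the window by one position drops its first value and gains the value one period later,
  -- which is the same.
  ∑<-shift : ∀ z → ∑< p (λ x → f (z + x)) ≡ ∑< p f
  ∑<-shift zero    = refl
  ∑<-shift (suc z) = trans (∑-cong (upTo p) (λ x → cong f (sym (+-suc z x)))) (trans step (∑<-shift z))
    where
    g : ℕ → ℕ
    g x = f (z + x)
    g-per : g p ≡ g 0
    g-per = trans (cong f (+-comm z p)) (trans (per z) (cong f (sym (+-identityʳ z))))
    step : ∑< p (g ∘ suc) ≡ ∑< p g
    step = +-cancelˡ-≡ (g 0) _ _ (begin
      g 0 + ∑< p (g ∘ suc)    ≡⟨ ∑<-suc p g ⟨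
      ∑< (suc p) g            ≡⟨ cong (λ k → ∑< k g) (+-comm 1 p) ⟩
      ∑< (p + 1) g            ≡⟨ ∑<-+ p 1 g ⟩
      ∑< p g + (g (p + 0) + 0)
        ≡⟨ cong (∑< p g +_) (trans (+-identityʳ _) (trans (cong g (+-identityʳ p)) g-per)) ⟩
      ∑< p g + g 0            ≡⟨ +-comm (∑< p g) (g 0) ⟩
      g 0 + ∑< p g            ∎)
      where open ≡-Reasoning

halve : ∀ z → ∃[ q ] (z ≡ 2 * q ⊎ z ≡ 1 + 2 * q)
halve zero    = 0 , inj₁ refl
halve (suc z) with halve z
... | q , inj₁ refl = q , inj₂ refl
... | q , inj₂ refl = suc q , inj₁ (sym (*-suc 2 q))

-- An odd factor permutes the residues modulo 2 ^ m. Instead of inverting it, the induction uses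
-- that it preserves parity: on each parity class it acts as the same factor modulo half the period,
-- combined with a shift by `e` on the odd class.
∑<-odd : ∀ m {f} → Periodic (2 ^ m) f → ∀ e → ∑< (2 ^ m) (λ x → f ((1 + 2 * e) * x)) ≡ ∑< (2 ^ m) f
∑<-odd zero {f} per e = cong (λ k → f k + 0) (*-zeroʳ (1 + 2 * e))
∑<-odd (suc m) {f} per e = begin
  ∑< (2 * M) (λ x → f (d * x))
    ≡⟨ ∑<-2* M _ ⟩
  ∑< M (λ x → f (d * (2 * x))) + ∑< M (λ x → f (d * (1 + 2 * x)))
    ≡⟨ cong₂ _+_ (∑-cong (upTo M) (λ x → cong f (even e x))) (∑-cong (upTo M) (λ x → cong f (odd e x))) ⟩
  ∑< M (λ x → f (2 * (d * x))) + ∑< M (λ x → f (1 + 2 * (e + d * x)))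
    ≡⟨ cong₂ _+_ (∑<-odd m evens e) (∑<-odd m (λ x → trans (cong odds (swap e M x)) (odds-per (e + x))) e) ⟩
  ∑< M (λ x → f (2 * x)) + ∑< M (λ x → odds (e + x))
    ≡⟨ cong (∑< M (λ x → f (2 * x)) +_) (∑<-shift {M} odds-per e) ⟩
  ∑< M (λ x → f (2 * x)) + ∑< M odds
    ≡⟨ ∑<-2* M f ⟨
  ∑< (2 * M) f ∎
  where
  open ≡-Reasoning
  M d : ℕ
  M = 2 ^ m
  d = 1 + 2 * e
  odds : ℕ → ℕ
  odds x = f (1 + 2 * x)
  even : ∀ e x → (1 + 2 * e) * (2 * x) ≡ 2 * ((1 + 2 * e) * x)
  even = solve-∀
  odd : ∀ e x → (1 + 2 * e) * (1 + 2 * x) ≡ 1 + 2 * (e + (1 + 2 * e) * x)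
  odd = solve-∀
  swap : ∀ e p x → e + (p + x) ≡ p + (e + x)
  swap = solve-∀
  evens : Periodic M (λ x → f (2 * x))
  evens x = trans (cong f (*-distribˡ-+ 2 M x)) (per (2 * x))
  odds-per : Periodic M odds
  odds-per x = trans (cong f (out M x)) (per (1 + 2 * x))
    where
    out : ∀ p x → 1 + 2 * (p + x) ≡ 2 * p + (1 + 2 * x)
    out = solve-∀

-- Right shifts and the leading bits of a product

infixl 6.5 _≫_
-- Division by 2 ^ h as iterated halving, so that induction on the shift removes the lowest bit. The
-- precedence makes `c + y ≫ m` shift only `y`, and `k * x ≫ m` the whole product.
_≫_ : ℕ → ℕ → ℕ
x ≫ zero  = x
x ≫ suc h = (x / 2) ≫ h

≫-+ : ∀ a b x → x ≫ (a + b) ≡ (x ≫ a) ≫ b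
≫-+ zero    b x = refl
≫-+ (suc a) b x = ≫-+ a b (x / 2)

[2*m+n]/2 : ∀ m n → (2 * m + n) / 2 ≡ m + n / 2
[2*m+n]/2 m n = trans (+-distrib-/-∣ˡ n (m∣m*n m))
  (cong (_+ n / 2) (trans (cong (_/ 2) (*-comm 2 m)) (m*n/n≡m m 2)))

[y*2^h+x]≫h : ∀ h y x → (y * 2 ^ h + x) ≫ h ≡ y + x ≫ h
[y*2^h+x]≫h zero    y x = cong (_+ x) (*-identityʳ y)
[y*2^h+x]≫h (suc h) y x = begin
  ((y * (2 * 2 ^ h) + x) / 2) ≫ h   ≡⟨ cong (λ k → ((k + x) / 2) ≫ h) (left-comm y (2 ^ h)) ⟩
  ((2 * (y * 2 ^ h) + x) / 2) ≫ h   ≡⟨ cong (_≫ h) ([2*m+n]/2 (y * 2 ^ h) x) ⟩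
  (y * 2 ^ h + x / 2) ≫ h           ≡⟨ [y*2^h+x]≫h h y (x / 2) ⟩
  y + (x / 2) ≫ h                   ∎
  where
  open ≡-Reasoning
  left-comm : ∀ y p → y * (2 * p) ≡ 2 * (y * p)
  left-comm = solve-∀

≫-remainder : ∀ h x → ∃[ r ] r < 2 ^ h × x ≡ r + (x ≫ h) * 2 ^ h
≫-remainder zero    x = 0 , z<s , sym (*-identityʳ x)
≫-remainder (suc h) x with r , r<2^h , eq ← ≫-remainder h (x / 2) =
  x % 2 + 2 * r ,
  ≤-trans (+-monoˡ-≤ (2 * r) (m%n<n x 2)) (≤-trans (≤-reflexive (sym (*-suc 2 r))) (*-monoʳ-≤ 2 r<2^h)) ,
  (begin
    x                                                    ≡⟨ m≡m%n+[m/n]*n x 2 ⟩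
    x % 2 + x / 2 * 2                                    ≡⟨ cong (λ k → x % 2 + k * 2) eq ⟩
    x % 2 + (r + (x ≫ suc h) * 2 ^ h) * 2                ≡⟨ regroup (x % 2) r (x ≫ suc h) (2 ^ h) ⟩
    x % 2 + 2 * r + (x ≫ suc h) * (2 * 2 ^ h)            ∎)
  where
  open ≡-Reasoning
  regroup : ∀ s r q p → s + (r + q * p) * 2 ≡ s + 2 * r + q * (2 * p)
  regroup = solve-∀

x<2^h⇒x≫h≡0 : ∀ h {x} → x < 2 ^ h → x ≫ h ≡ 0
x<2^h⇒x≫h≡0 zero    {zero}  _ = refl
x<2^h⇒x≫h≡0 zero    {suc x} (s≤s ())
x<2^h⇒x≫h≡0 (suc h) {x} lt = x<2^h⇒x≫h≡0 h (m<n*o⇒m/o<n (subst (x <_) (*-comm 2 (2 ^ h)) lt))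

module _ {g φ} (per : Periodic (2 ^ g) φ) where

  ≫-periodic : ∀ h → Periodic (2 ^ (h + g)) (λ x → φ (x ≫ h))
  ≫-periodic h x = begin
    φ ((2 ^ (h + g) + x) ≫ h)
      ≡⟨ cong (λ p → φ ((p + x) ≫ h)) (trans (^-distribˡ-+-* 2 h g) (*-comm (2 ^ h) (2 ^ g))) ⟩
    φ ((2 ^ g * 2 ^ h + x) ≫ h)   ≡⟨ cong φ ([y*2^h+x]≫h h (2 ^ g) x) ⟩
    φ (2 ^ g + x ≫ h)             ≡⟨ per (x ≫ h) ⟩
    φ (x ≫ h)                     ∎
    where open ≡-Reasoning

  -- Every d < 2 ^ h is an odd number times a power of two that divides 2 ^ h; the latter only acts
  -- inside the blocks of length 2 ^ h on which the summand is constant.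
  ∑<-scale : ∀ h d z → 0 < d → d < 2 ^ h →
    ∑< (2 ^ (h + g)) (λ x → φ ((z + d * x) ≫ h)) ≡ ∑< (2 ^ (h + g)) (λ x → φ (x ≫ h))
  ∑<-scale zero    (suc d) z _ (s≤s ())
  ∑<-scale (suc h) d z 0<d d<2^ with halve d
  ... | e , inj₂ refl = trans
    (∑<-odd (suc h + g) {λ x → φ ((z + x) ≫ suc h)}
      (λ x → trans (cong (λ k → φ (k ≫ suc h)) (swap z (2 ^ (suc h + g)) x)) (≫-periodic (suc h) (z + x))) e)
    (∑<-shift {2 ^ (suc h + g)} (≫-periodic (suc h)) z)
    where
    swap : ∀ e p x → e + (p + x) ≡ p + (e + x)
    swap = solve-∀
  ... | e , inj₁ refl = begin
    ∑< (2 * M) (λ x → φ ((z + 2 * e * x) ≫ suc h))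
      ≡⟨ ∑-cong (upTo (2 * M)) (λ x → cong (λ k → φ (k ≫ h)) (pull x)) ⟩
    ∑< (2 * M) ψ
      ≡⟨ ∑<-* 2 M ψ ⟩
    ∑< M ψ + (∑< M (λ x → ψ (1 * M + x)) + 0)
      ≡⟨ cong (λ k → ∑< M ψ + (k + 0)) (∑-cong (upTo M) (periodic-* ψ-per 1)) ⟩
    2 * ∑< M ψ
      ≡⟨ cong (2 *_) (∑<-scale h e (z / 2) (*-cancelˡ-< 2 0 e 0<d) (*-cancelˡ-< 2 e (2 ^ h) d<2^)) ⟩
    2 * ∑< M (λ x → φ (x ≫ h))
      ≡⟨ cong (∑< M (λ x → φ (x ≫ h)) +_) (+-identityʳ _) ⟩
    ∑< M (λ x → φ (x ≫ h)) + ∑< M (λ x → φ (x ≫ h))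
      ≡⟨ cong₂ _+_ (∑-cong (upTo M) (λ x → cong (λ k → φ (k ≫ h)) (sym (even x))))
                   (∑-cong (upTo M) (λ x → cong (λ k → φ (k ≫ h)) (sym (odd x)))) ⟩
    ∑< M (λ x → φ ((2 * x) ≫ suc h)) + ∑< M (λ x → φ ((1 + 2 * x) ≫ suc h))
      ≡⟨ ∑<-2* M _ ⟨
    ∑< (2 * M) (λ x → φ (x ≫ suc h)) ∎
    where
    open ≡-Reasoning
    M : ℕ
    M = 2 ^ (h + g)
    ψ : ℕ → ℕ
    ψ x = φ ((z / 2 + e * x) ≫ h)
    pull : ∀ x → (z + 2 * e * x) / 2 ≡ z / 2 + e * x
    pull x = begin
      (z + 2 * e * x) / 2   ≡⟨ cong (_/ 2) (regroup z e x) ⟩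
      (2 * (e * x) + z) / 2 ≡⟨ [2*m+n]/2 (e * x) z ⟩
      e * x + z / 2         ≡⟨ +-comm (e * x) (z / 2) ⟩
      z / 2 + e * x         ∎
      where
      regroup : ∀ z e x → z + 2 * e * x ≡ 2 * (e * x) + z
      regroup = solve-∀
    even : ∀ x → (2 * x) / 2 ≡ x
    even x = trans (cong (_/ 2) (*-comm 2 x)) (m*n/n≡m x 2)
    odd : ∀ x → (1 + 2 * x) / 2 ≡ x
    odd x = trans (cong (_/ 2) (+-comm 1 (2 * x))) (trans ([2*m+n]/2 x 1) (+-identityʳ x))
    ψ-per : Periodic M ψ
    ψ-per x = trans (cong (λ k → φ (k ≫ h)) (regroup (z / 2) e M x))
                (periodic-* (≫-periodic h) e (z / 2 + e * x))
      where
      regroup : ∀ z e M x → z + e * (M + x) ≡ e * M + (z + e * x)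
      regroup = solve-∀

  ∑<-blocks : ∀ h → ∑< (2 ^ (h + g)) (λ x → φ (x ≫ h)) ≡ 2 ^ h * ∑< (2 ^ g) φ
  ∑<-blocks h = begin
    ∑< (2 ^ (h + g)) (λ x → φ (x ≫ h))
      ≡⟨ cong (λ k → ∑< k (λ x → φ (x ≫ h))) (trans (^-distribˡ-+-* 2 h g) (*-comm (2 ^ h) (2 ^ g))) ⟩
    ∑< (2 ^ g * 2 ^ h) (λ x → φ (x ≫ h))
      ≡⟨ ∑<-* (2 ^ g) (2 ^ h) _ ⟩
    ∑< (2 ^ g) (λ c → ∑< (2 ^ h) (λ x → φ ((c * 2 ^ h + x) ≫ h)))
      ≡⟨ ∑-cong (upTo (2 ^ g)) (λ c →
           trans (∑<-cong (2 ^ h) (λ x x< → cong φ (block c x x<))) (∑<-const (2 ^ h) (φ c))) ⟩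
    ∑< (2 ^ g) (λ c → 2 ^ h * φ c)
      ≡⟨ ∑-*ˡ (upTo (2 ^ g)) (2 ^ h) φ ⟩
    2 ^ h * ∑< (2 ^ g) φ ∎
    where
    open ≡-Reasoning
    block : ∀ c x → x < 2 ^ h → (c * 2 ^ h + x) ≫ h ≡ c
    block c x x< = trans ([y*2^h+x]≫h h c x) (trans (cong (c +_) (x<2^h⇒x≫h≡0 h x<)) (+-identityʳ c))

∑<-mono-≤ : ∀ n {f g} → (∀ x → x < n → f x ≤ g x) → ∑< n f ≤ ∑< n g
∑<-mono-≤ zero    le = z≤n
∑<-mono-≤ (suc n) {f} {g} le rewrite ∑<-suc n f | ∑<-suc n g =
  +-mono-≤ (le 0 z<s) (∑<-mono-≤ n (λ x x<n → le (suc x) (s<s x<n)))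

-- Sums over all instances

∑-cartesianProductWith : ∀ {K : Set} (f : I → J → K) xs ys G →
  ∑ (List.cartesianProductWith f xs ys) G ≡ ∑ xs (λ x → ∑ ys (λ y → G (f x y)))
∑-cartesianProductWith f []       ys G = refl
∑-cartesianProductWith f (x ∷ xs) ys G =
  trans (∑-++ (List.map (f x) ys) _ G)
    (cong₂ _+_ (∑-map ys (f x) G) (∑-cartesianProductWith f xs ys G))

∑-allFin : ∀ n f → ∑ (List.allFin n) (f ∘ toℕ) ≡ ∑< n f
∑-allFin n f = ∑-tabulate n (λ i → i) f (λ _ → refl)
  where
  ∑-tabulate : ∀ n (k : Fin n → I) (g : ℕ → ℕ) {f : I → ℕ} → (∀ i → f (k i) ≡ g (toℕ i)) →
               ∑ (List.tabulate k) f ≡ ∑< n g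
  ∑-tabulate zero    k g eq = refl
  ∑-tabulate (suc n) k g eq =
    trans (cong₂ _+_ (eq Fin.zero) (∑-tabulate n (k ∘ Fin.suc) (g ∘ suc) (eq ∘ Fin.suc))) (sym (∑<-suc n g))

*-interchange : ∀ a b c d → (a * b) * (c * d) ≡ (a * c) * (b * d)
*-interchange = solve-∀

^-distribʳ-* : ∀ n x y → (x * y) ^ n ≡ x ^ n * y ^ n
^-distribʳ-* zero    x y = refl
^-distribʳ-* (suc n) x y = trans (cong (x * y *_) (^-distribʳ-* n x y)) (*-interchange x y (x ^ n) (y ^ n))

∏ : ∀ {N n} → (ℕ → ℕ → ℕ) → Vec ℕ n → Vec (Fin N) n → ℕ
∏ G []       []      = 1
∏ G (σ ∷ σs) (x ∷ a) = G σ (toℕ x) * ∏ G σs a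

∏-* : ∀ {N n} G H (σs : Vec ℕ n) (a : Vec (Fin N) n) →
      ∏ G σs a * ∏ H σs a ≡ ∏ (λ σ x → G σ x * H σ x) σs a
∏-* G H []       []      = refl
∏-* G H (σ ∷ σs) (x ∷ a) =
  trans (*-interchange (G σ (toℕ x)) _ _ _) (cong (G σ (toℕ x) * H σ (toℕ x) *_) (∏-* G H σs a))

-- Independence of the entries: the sum factors coordinate by coordinate. As every target `σ` gives
-- the same sum `c`, the choice of targets does not affect the count.
∑-∏ : ∀ N {n} G c → (∀ σ → ∑< N (G σ) ≡ c) → (σs : Vec ℕ n) → ∑ (allVecs N n) (∏ G σs) ≡ c ^ n
∑-∏ N G c eq []               = refl
∑-∏ N {suc n} G c eq (σ ∷ σs) = begin
  ∑ (allVecs N (suc n)) (∏ G (σ ∷ σs))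
    ≡⟨ ∑-cartesianProductWith _∷_ (List.allFin N) (allVecs N n) (∏ G (σ ∷ σs)) ⟩
  ∑ (List.allFin N) (λ x → ∑ (allVecs N n) (λ a → G σ (toℕ x) * ∏ G σs a))
    ≡⟨ ∑-cong (List.allFin N) (λ x → trans (∑-*ˡ (allVecs N n) (G σ (toℕ x)) (∏ G σs))
         (trans (cong (G σ (toℕ x) *_) (∑-∏ N G c eq σs)) (*-comm _ (c ^ n)))) ⟩
  ∑ (List.allFin N) (λ x → c ^ n * G σ (toℕ x))
    ≡⟨ ∑-*ˡ (List.allFin N) (c ^ n) (G σ ∘ toℕ) ⟩
  c ^ n * ∑ (List.allFin N) (G σ ∘ toℕ)
    ≡⟨ cong (c ^ n *_) (trans (∑-allFin N (G σ)) (eq σ)) ⟩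
  c ^ n * c
    ≡⟨ *-comm (c ^ n) c ⟩
  c ^ suc n ∎
  where open ≡-Reasoning

length-filter : ∀ {P : Pred I 0ℓ} (P? : Decidable P) xs →
                length (List.filter P? xs) ≡ ∑ xs (λ x → if does (P? x) then 1 else 0)
length-filter P? []       = refl
length-filter P? (x ∷ xs) with P? x
... | yes _ = cong suc (length-filter P? xs)
... | no _  = length-filter P? xs

2xy≤x²+y² : ∀ x y → 2 * (x * y) ≤ x * x + y * y
2xy≤x²+y² x y with ≤-total x y
... | inj₁ x≤y with d , refl ← m≤n⇒∃[o]m+o≡n x≤y = subst (2 * (x * (x + d)) ≤_) (square x d) (m≤m+n _ (d * d))
  where
  square : ∀ x d → 2 * (x * (x + d)) + d * d ≡ x * x + (x + d) * (x + d)
  square = solve-∀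
... | inj₂ y≤x with d , refl ← m≤n⇒∃[o]m+o≡n y≤x = subst (2 * ((y + d) * y) ≤_) (square y d) (m≤m+n _ (d * d))
  where
  square : ∀ y d → 2 * ((y + d) * y) + d * d ≡ (y + d) * (y + d) + y * y
  square = solve-∀

-- Chebyshev's inequality for a count with mean μ and variance at most μ.
secondMoment : ∀ {P : Pred I 0ℓ} (P? : Decidable P) xs X μ T .{{_ : NonZero μ}} →
  (∀ x → ¬ P x → X x ≡ 0) → ∑ xs X ≡ μ * T → ∑ xs (λ x → X x * X x) ≤ μ * T + μ * μ * T →
  μ * T ≤ T + μ * length (List.filter P? xs)
secondMoment P? xs X μ T zeros mean square =
  *-cancelˡ-≤ μ (+-cancelʳ-≤ (μ * μ * T) _ _ (begin
    μ * (μ * T) + μ * μ * T                            ≡⟨ double μ T ⟩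
    2 * μ * (μ * T)                                    ≡⟨ cong (2 * μ *_) mean ⟨
    2 * μ * ∑ xs X                                     ≡⟨ ∑-*ˡ xs (2 * μ) X ⟨
    ∑ xs (λ x → 2 * μ * X x)                           ≤⟨ ∑-mono-≤ xs pointwise ⟩
    ∑ xs (λ x → X x * X x + μ * μ * hit x)             ≡⟨ ∑-+ xs (λ x → X x * X x) (λ x → μ * μ * hit x) ⟩
    ∑ xs (λ x → X x * X x) + ∑ xs (λ x → μ * μ * hit x)
      ≡⟨ cong (∑ xs (λ x → X x * X x) +_) (∑-*ˡ xs (μ * μ) hit) ⟩
    ∑ xs (λ x → X x * X x) + μ * μ * ∑ xs hit
      ≡⟨ cong (λ k → ∑ xs (λ x → X x * X x) + μ * μ * k) (length-filter P? xs) ⟨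
    ∑ xs (λ x → X x * X x) + μ * μ * G                 ≤⟨ +-monoˡ-≤ (μ * μ * G) square ⟩
    μ * T + μ * μ * T + μ * μ * G                      ≡⟨ regroup μ T G ⟩
    μ * (T + μ * G) + μ * μ * T                        ∎))
  where
  open ≤-Reasoning
  hit : _ → ℕ
  hit x = if does (P? x) then 1 else 0
  G : ℕ
  G = length (List.filter P? xs)
  double : ∀ μ T → μ * (μ * T) + μ * μ * T ≡ 2 * μ * (μ * T)
  double = solve-∀
  regroup : ∀ μ T G → μ * T + μ * μ * T + μ * μ * G ≡ μ * (T + μ * G) + μ * μ * T
  regroup = solve-∀
  -- Where `P` holds, this is the nonnegativity of the square of X - μ; elsewhere X vanishes.
  -- Summation then bounds the count without forming a variance.
  pointwise : ∀ x → 2 * μ * X x ≤ X x * X x + μ * μ * hit x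
  pointwise x with P? x
  ... | yes _ = begin
    2 * μ * X x                ≡⟨ trans (*-assoc 2 μ (X x)) (cong (2 *_) (*-comm μ (X x))) ⟩
    2 * (X x * μ)              ≤⟨ 2xy≤x²+y² (X x) μ ⟩
    X x * X x + μ * μ          ≡⟨ cong (X x * X x +_) (*-identityʳ (μ * μ)) ⟨
    X x * X x + μ * μ * 1      ∎
  ... | no ¬p rewrite zeros x ¬p = ≤-trans (≤-reflexive (*-zeroʳ (2 * μ))) z≤n

-- Multiply-shift hashing and its first two moments

module _ (h g : ℕ) where

  private
    m M T P : ℕ
    m = h + g
    M = 2 ^ m
    T = 2 ^ h
    P = 2 ^ g
    instance
      P≢0 : NonZero P
      P≢0 = m^n≢0 2 g
      M≢0 : NonZero M
      M≢0 = m^n≢0 2 m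

  multiplier : ℕ → ℕ
  multiplier t = 1 + t * M

  residueIs : ℕ → ℕ → ℕ
  residueIs σ y = [ y % P ≐ σ % P ]

  residueIs-periodic : ∀ σ → Periodic P (residueIs σ)
  residueIs-periodic σ y = cong [_≐ σ % P ] (trans (cong (_% P) (+-comm P y)) ([m+n]%n≡m%n y P))

  ∑<-residueIs : ∀ σ → ∑< P (residueIs σ) ≡ 1
  ∑<-residueIs σ = trans (∑<-cong P (λ y y<P → cong [_≐ σ % P ] (m<n⇒m%n≡m y<P))) (∑<-[≐] (m%n<n σ P))

  residueIs-idem : ∀ σ y → residueIs σ y * residueIs σ y ≡ residueIs σ y
  residueIs-idem σ y with y % P ≡ᵇ σ % P
  ... | true  = refl
  ... | false = refl

  -- Of the 2 m = m + h + g bits of the product modulo `M * M`, the g leading ones are compared with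
  -- `σ`. The shift is split because the first part exposes the upper half and the second is the
  -- shift of the hash function.
  hit : ℕ → ℕ → ℕ → ℕ
  hit t σ x = residueIs σ (multiplier t * x ≫ m ≫ h)

  module _ (σ : ℕ) where

    private
      f : ℕ → ℕ
      f x = residueIs σ (x ≫ h)

      f-periodic : Periodic M f
      f-periodic = ≫-periodic (residueIs-periodic σ) h

      ∑f : ∑< M f ≡ T
      ∑f = trans (∑<-blocks (residueIs-periodic σ) h)
             (trans (cong (T *_) (∑<-residueIs σ)) (*-identityʳ T))

    -- Multiply-shift hashing: t multiplies the lower half y of the item, and the upper half c is a random shift.
    hit-hash : ∀ t c y → y < M → hit t σ (c * M + y) ≡ f (t * y + c)
    hit-hash t c y y<M = begin
      f ((multiplier t * (c * M + y)) ≫ m)       ≡⟨ cong (λ k → f (k ≫ m)) (expand t c y M) ⟩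
      f ((((t * c) * M + (t * y + c)) * M + y) ≫ m) ≡⟨ cong f ([y*2^h+x]≫h m ((t * c) * M + (t * y + c)) y) ⟩
      f ((t * c) * M + (t * y + c) + y ≫ m)
        ≡⟨ cong (λ k → f ((t * c) * M + (t * y + c) + k)) (x<2^h⇒x≫h≡0 m y<M) ⟩
      f ((t * c) * M + (t * y + c) + 0)          ≡⟨ cong f (+-identityʳ _) ⟩
      f ((t * c) * M + (t * y + c))              ≡⟨ periodic-* f-periodic (t * c) (t * y + c) ⟩
      f (t * y + c) ∎
      where
      open ≡-Reasoning
      expand : ∀ t c y M → (1 + t * M) * (c * M + y) ≡ ((t * c) * M + (t * y + c)) * M + y
      expand = solve-∀

    -- A uniform item is a pair of independent uniform halves. The lower half `y` becomes the outer
    -- variable because, for fixed `y`, summing over `c` absorbs a shift by `t * y`.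
    ∑<-halves : ∀ (F : ℕ → ℕ) (k : ℕ → ℕ → ℕ) → (∀ c y → y < M → F (c * M + y) ≡ k y c) →
                ∑< (M * M) F ≡ ∑< M (λ y → ∑< M (k y))
    ∑<-halves F k eq = begin
      ∑< (M * M) F                                ≡⟨ ∑<-* M M F ⟩
      ∑< M (λ c → ∑< M (λ y → F (c * M + y)))     ≡⟨ ∑-cong (upTo M) (λ c → ∑<-cong M (eq c)) ⟩
      ∑< M (λ c → ∑< M (λ y → k y c))             ≡⟨ ∑-swap (upTo M) (upTo M) (λ c y → k y c) ⟩
      ∑< M (λ y → ∑< M (k y))                     ∎
      where open ≡-Reasoning

    ∑<-hit : ∀ t → ∑< (M * M) (hit t σ) ≡ M * T
    ∑<-hit t = begin
      ∑< (M * M) (hit t σ)                        ≡⟨ ∑<-halves (hit t σ) (λ y c → f (t * y + c)) (hit-hash t) ⟩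
      ∑< M (λ y → ∑< M (λ c → f (t * y + c)))
        ≡⟨ ∑-cong (upTo M) (λ y → trans (∑<-shift {M} {f} f-periodic (t * y)) ∑f) ⟩
      ∑< M (λ _ → T)                              ≡⟨ ∑<-const M T ⟩
      M * T                                       ∎
      where open ≡-Reasoning

    -- Exact pairwise independence, with joint probability P ^ -2. Absorbing `t * y` into `c` leaves
    -- the hashes of `c` and `c + d * y`; for fixed `c` the second has uniform leading bits as `y`
    -- varies, by `∑<-scale`.
    ∑<-hit-hit : ∀ t d → 0 < d → d < T → ∑< (M * M) (λ x → hit t σ x * hit (t + d) σ x) ≡ T * T
    ∑<-hit-hit t d 0<d d<T = begin
      ∑< (M * M) (λ x → hit t σ x * hit (t + d) σ x)
        ≡⟨ ∑<-halves _ (λ y c → f (t * y + c) * f (t * y + c + d * y)) pair ⟩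
      ∑< M (λ y → ∑< M (λ c → f (t * y + c) * f (t * y + c + d * y)))
        ≡⟨ ∑-cong (upTo M) (λ y → ∑<-shift {M} {λ c → f c * f (c + d * y)} (both y) (t * y)) ⟩
      ∑< M (λ y → ∑< M (λ c → f c * f (c + d * y)))
        ≡⟨ ∑-swap (upTo M) (upTo M) (λ y c → f c * f (c + d * y)) ⟩
      ∑< M (λ c → ∑< M (λ y → f c * f (c + d * y)))
        ≡⟨ ∑-cong (upTo M) (λ c → trans (∑-*ˡ (upTo M) (f c) (λ y → f (c + d * y)))
             (trans (cong (f c *_) (trans (∑<-scale (residueIs-periodic σ) h d c 0<d d<T) ∑f))
                    (*-comm (f c) T))) ⟩
      ∑< M (λ c → T * f c)
        ≡⟨ trans (∑-*ˡ (upTo M) T f) (cong (T *_) ∑f) ⟩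
      T * T ∎
      where
      open ≡-Reasoning
      regroup : ∀ t d y c → (t + d) * y + c ≡ t * y + c + d * y
      regroup = solve-∀
      pair : ∀ c y → y < M →
        hit t σ (c * M + y) * hit (t + d) σ (c * M + y) ≡ f (t * y + c) * f (t * y + c + d * y)
      pair c y y<M = cong₂ _*_ (hit-hash t c y y<M)
        (trans (hit-hash (t + d) c y y<M) (cong f (regroup t d y c)))
      both : ∀ y → Periodic M (λ c → f c * f (c + d * y))
      both y c = cong₂ _*_ (f-periodic c) (trans (cong f (+-assoc M c (d * y))) (f-periodic (c + d * y)))

  module _ {e n} (h≡e+gn : h ≡ e + g * n) {N} (N≡M² : N ≡ M * M) (σs : Vec ℕ n) where

    private
      μ p : ℕ
      -- The expected number of successful `t` among `T`; `p` counts the instances on which two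
      -- given distinct values of `t` both succeed.
      μ = 2 ^ e
      p = (T * T) ^ n

      T≡μP^n : T ≡ μ * P ^ n
      T≡μP^n = trans (cong (2 ^_) h≡e+gn)
        (trans (^-distribˡ-+-* 2 e (g * n)) (cong (μ *_) (sym (^-*-assoc 2 g n))))

      M≡TP : M ≡ T * P
      M≡TP = ^-distribˡ-+-* 2 h g

      N^n≡ : N ^ n ≡ P ^ n * (M * T) ^ n
      N^n≡ = trans (cong (_^ n) (trans N≡M² (trans (cong (_* M) M≡TP) (regroup T P M))))
        (^-distribʳ-* n P (M * T))
        where
        regroup : ∀ T P M → T * P * M ≡ P * (M * T)
        regroup = solve-∀

      T*MT^n : T * (M * T) ^ n ≡ μ * N ^ n
      T*MT^n = trans (cong (_* (M * T) ^ n) T≡μP^n)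
        (trans (*-assoc μ (P ^ n) _) (cong (μ *_) (sym N^n≡)))

      MT^n≡ : (M * T) ^ n ≡ P ^ n * p
      MT^n≡ = trans (cong (_^ n) (trans (cong (_* T) M≡TP) (regroup T P))) (^-distribʳ-* n P (T * T))
        where
        regroup : ∀ T P → T * P * T ≡ P * (T * T)
        regroup = solve-∀

      T*T*p : T * (T * p) ≡ μ * μ * N ^ n
      T*T*p = begin
        T * (T * p)                       ≡⟨ cong (λ k → k * (k * p)) T≡μP^n ⟩
        μ * P ^ n * (μ * P ^ n * p)       ≡⟨ regroup μ (P ^ n) p ⟩
        μ * μ * (P ^ n * (P ^ n * p))     ≡⟨ cong (λ k → μ * μ * (P ^ n * k)) (sym MT^n≡) ⟩
        μ * μ * (P ^ n * (M * T) ^ n)     ≡⟨ cong (μ * μ *_) (sym N^n≡) ⟩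
        μ * μ * N ^ n                     ∎
        where
        open ≡-Reasoning
        regroup : ∀ μ q p → μ * q * (μ * q * p) ≡ μ * μ * (q * (q * p))
        regroup = solve-∀

    hits : Vec (Fin N) n → ℕ
    hits a = ∑< T (λ t → ∏ (hit t) σs a)

    private
      as : List (Vec (Fin N) n)
      as = allVecs N n

      over-N : ∀ F {c} → ∑< (M * M) F ≡ c → ∑< N F ≡ c
      over-N F eq = trans (cong (λ k → ∑< k F) N≡M²) eq

      ∑-pair : ∀ {t u} → t < u → u < T → ∑ as (λ a → ∏ (hit t) σs a * ∏ (hit u) σs a) ≡ p
      ∑-pair {t} {u} t<u u<T with d , refl ← m≤n⇒∃[o]m+o≡n t<u = trans (∑-cong as (∏-* (hit t) (hit u) σs))
        (∑-∏ N (λ σ x → hit t σ x * hit u σ x) (T * T) (λ σ → over-N _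
          (subst (λ v → ∑< (M * M) (λ x → hit t σ x * hit v σ x) ≡ T * T) (+-suc t d)
            (∑<-hit-hit σ t (suc d) z<s
              (≤-<-trans (m≤n+m (suc d) t) (subst (_< T) (sym (+-suc t d)) u<T))))) σs)

      ∑-single : ∀ t → ∑ as (∏ (hit t) σs) ≡ (M * T) ^ n
      ∑-single t = ∑-∏ N (hit t) (M * T) (λ σ → over-N (hit t σ) (∑<-hit σ t)) σs

      -- One bound for all pairs, so that the double sum need not be split. On the diagonal the
      -- product of two equal indicators is the indicator itself, whose count is the extra term.
      ∑-any : ∀ t u → t < T → u < T →
        ∑ as (λ a → ∏ (hit t) σs a * ∏ (hit u) σs a) ≤ p + (M * T) ^ n * [ u ≐ t ]
      ∑-any t u t<T u<T with <-cmp t u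
      ... | tri< t<u _ _ = ≤-trans (≤-reflexive (∑-pair t<u u<T)) (m≤m+n p _)
      ... | tri> _ _ u<t = ≤-trans
        (≤-reflexive (trans (∑-cong as (λ a → *-comm (∏ (hit t) σs a) _)) (∑-pair u<t t<T))) (m≤m+n p _)
      ... | tri≈ _ refl _ = ≤-trans (≤-reflexive diagonal)
        (≤-trans (≤-reflexive (sym (trans (cong ((M * T) ^ n *_) (≐-refl t)) (*-identityʳ _))))
          (m≤n+m _ p))
        where
        ≐-refl : ∀ t → [ t ≐ t ] ≡ 1
        ≐-refl zero    = refl
        ≐-refl (suc t) = ≐-refl t
        diagonal : ∑ as (λ a → ∏ (hit t) σs a * ∏ (hit t) σs a) ≡ (M * T) ^ n
        diagonal = trans (∑-cong as (∏-* (hit t) (hit t) σs))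
          (∑-∏ N (λ σ x → hit t σ x * hit t σ x) (M * T)
            (λ σ → trans (∑-cong (upTo N) (λ x → residueIs-idem σ _)) (over-N (hit t σ) (∑<-hit σ t))) σs)

    ∑-hits : ∑ as hits ≡ μ * N ^ n
    ∑-hits = begin
      ∑ as (λ a → ∑< T (λ t → ∏ (hit t) σs a))  ≡⟨ ∑-swap as (upTo T) (λ a t → ∏ (hit t) σs a) ⟩
      ∑< T (λ t → ∑ as (∏ (hit t) σs))          ≡⟨ ∑-cong (upTo T) ∑-single ⟩
      ∑< T (λ _ → (M * T) ^ n)                  ≡⟨ ∑<-const T _ ⟩
      T * (M * T) ^ n                           ≡⟨ T*MT^n ⟩
      μ * N ^ n                                 ∎
      where open ≡-Reasoning

    -- In the expanded square, `p` summed over all T * T pairs gives the squared mean and the extra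
    -- diagonal terms give the mean, each times the number of instances.
    ∑-hits² : ∑ as (λ a → hits a * hits a) ≤ μ * N ^ n + μ * μ * N ^ n
    ∑-hits² = begin
      ∑ as (λ a → hits a * hits a)
        ≡⟨ ∑-cong as (λ a → trans (sym (∑-*ˡ (upTo T) (hits a) (λ t → ∏ (hit t) σs a)))
             (∑-cong (upTo T) (λ t → trans (*-comm (hits a) _)
               (sym (∑-*ˡ (upTo T) (∏ (hit t) σs a) (λ u → ∏ (hit u) σs a)))))) ⟩
      ∑ as (λ a → ∑< T (λ t → ∑< T (λ u → ∏ (hit t) σs a * ∏ (hit u) σs a)))
        ≡⟨ ∑-swap as (upTo T) _ ⟩
      ∑< T (λ t → ∑ as (λ a → ∑< T (λ u → ∏ (hit t) σs a * ∏ (hit u) σs a)))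
        ≡⟨ ∑-cong (upTo T) (λ t → ∑-swap as (upTo T) _) ⟩
      ∑< T (λ t → ∑< T (λ u → ∑ as (λ a → ∏ (hit t) σs a * ∏ (hit u) σs a)))
        ≤⟨ ∑<-mono-≤ T (λ t t<T → ∑<-mono-≤ T (λ u u<T → ∑-any t u t<T u<T)) ⟩
      ∑< T (λ t → ∑< T (λ u → p + (M * T) ^ n * [ u ≐ t ]))
        ≡⟨ ∑<-cong T (λ t t<T → trans (∑-+ (upTo T) (λ _ → p) (λ u → (M * T) ^ n * [ u ≐ t ]))
             (cong₂ _+_ (∑<-const T p) (trans (∑-*ˡ (upTo T) ((M * T) ^ n) [_≐ t ])
               (trans (cong ((M * T) ^ n *_) (∑<-[≐] t<T)) (*-identityʳ _))))) ⟩
      ∑< T (λ _ → T * p + (M * T) ^ n)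
        ≡⟨ ∑<-const T _ ⟩
      T * (T * p + (M * T) ^ n)
        ≡⟨ trans (*-distribˡ-+ T (T * p) _) (+-comm (T * (T * p)) _) ⟩
      T * (M * T) ^ n + T * (T * p)
        ≡⟨ cong₂ _+_ T*MT^n T*T*p ⟩
      μ * N ^ n + μ * μ * N ^ n ∎
      where open ≤-Reasoning

-- Witnesses

-- The prescribed leading bits: all zero except for the last item. There `τ` will be 2 ^ (g - 1), a
-- set top bit followed by zeros.
targets : ∀ n → ℕ → Vec ℕ n
targets zero          τ = []
targets (suc zero)    τ = τ ∷ []
targets (suc (suc n)) τ = 0 ∷ targets (suc n) τ

[≐]≢0⇒≡ : ∀ x y → [ x ≐ y ] ≢ 0 → x ≡ y
[≐]≢0⇒≡ x y ≢0 with x ≡ᵇ y in eq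
... | true  = ≡ᵇ⇒≡ x y (subst Bool.T (sym eq) _)
... | false = contradiction refl ≢0

*≢0 : ∀ m n → m * n ≢ 0 → m ≢ 0 × n ≢ 0
*≢0 m n mn≢0 = (λ m≡0 → mn≢0 (cong (_* n) m≡0)) , (λ n≡0 → mn≢0 (trans (cong (m *_) n≡0) (*-zeroʳ m)))

module _ (h g′ b : ℕ) (b≡ : b ≡ (h + suc g′) + (h + suc g′)) where

  private
    g m M P U N τ : ℕ
    g = suc g′
    m = h + g
    M = 2 ^ m
    P = 2 ^ g
    -- The weight of the lowest prescribed bit: residues with leading bits `σ` lie between σ U and
    -- (σ + 1) U.
    U = 2 ^ (m + h)
    N = 2 ^ b
    τ = 2 ^ g′
    instance
      P≢0 : NonZero P
      P≢0 = m^n≢0 2 g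
      N≢0 : NonZero N
      N≢0 = m^n≢0 2 b

    N≡PU : N ≡ P * U
    N≡PU = trans (cong (2 ^_) (trans b≡ (regroup h g))) (^-distribˡ-+-* 2 g (m + h))
      where
      regroup : ∀ h g → (h + g) + (h + g) ≡ g + (h + g + h)
      regroup = solve-∀

  hit⇒residue : ∀ t σ x → σ < P → hit h g t σ x ≢ 0 →
                ∃[ r ] r < U × (multiplier h g t * x) % N ≡ r + σ * U
  hit⇒residue t σ x σ<P hit≢0 with r , r<U , eq ← ≫-remainder (m + h) (multiplier h g t * x) =
    r , r<U , %-unique N {c = q / P} (subst (r + σ * U <_) (sym N≡PU) bound) (begin
      r + σ * U + q / P * N        ≡⟨ cong (λ k → r + σ * U + q / P * k) N≡PU ⟩
      r + σ * U + q / P * (P * U)  ≡⟨ regroup r σ U (q / P) P ⟩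
      r + (σ + q / P * P) * U      ≡⟨ cong (λ k → r + (k + q / P * P) * U) (sym q%P≡σ) ⟩
      r + (q % P + q / P * P) * U  ≡⟨ cong (λ k → r + k * U) (m≡m%n+[m/n]*n q P) ⟨
      r + q * U                    ≡⟨ eq ⟨
      multiplier h g t * x         ∎)
    where
    open ≡-Reasoning
    q : ℕ
    q = (multiplier h g t * x) ≫ (m + h)
    q%P≡σ : q % P ≡ σ
    q%P≡σ = trans (cong (_% P) (≫-+ m h (multiplier h g t * x)))
      (trans ([≐]≢0⇒≡ ((multiplier h g t * x ≫ m ≫ h) % P) (σ % P) hit≢0) (m<n⇒m%n≡m σ<P))
    bound : r + σ * U < P * U
    bound = ≤-trans (+-monoˡ-≤ (σ * U) r<U) (*-monoˡ-≤ U σ<P)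
    regroup : ∀ r σ U c P → r + σ * U + c * (P * U) ≡ r + (σ + c * P) * U
    regroup = solve-∀

  private
    τ<P : τ < P
    τ<P = ^-monoʳ-< 2 (s<s z<s) (n<1+n g′)

  hits⇒residues : ∀ {n} t (a : Instance (suc n) b) y → ∏ (hit h g t) (targets (suc n) τ) a ≢ 0 →
    let rs = residues b (multiplier h g t) a in
    Vec.sum rs < suc n * U + τ * U × τ * U ≤ finalOr y rs
  hits⇒residues {zero} t (x ∷ []) y ≢0
    with r , r<U , eq ← hit⇒residue t τ (toℕ x) τ<P (proj₁ (*≢0 (hit h g t τ (toℕ x)) 1 ≢0)) rewrite eq =
    subst₂ _<_ (sym (+-identityʳ _)) (cong (_+ τ * U) (sym (+-identityʳ U)))
      (+-monoˡ-< (τ * U) r<U) ,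
    m≤n+m (τ * U) r
  hits⇒residues {suc n} t (x ∷ a) y ≢0
    with hit≢0 , rest≢0 ← *≢0 (hit h g t 0 (toℕ x)) _ ≢0
    with r , r<U , eq ← hit⇒residue t 0 (toℕ x) (m^n>0 2 g) hit≢0
       | lt , le ← hits⇒residues t a ((multiplier h g t * toℕ x) % N) rest≢0 =
    <-≤-trans (+-mono-< (subst (_< U) (sym (trans eq (+-identityʳ r))) r<U) lt)
      (≤-reflexive (sym (+-assoc U (suc n * U) (τ * U)))) ,
    le

  -- A budget in units of `U`: the multiplier and the n + 1 remainders need at most one unit each,
  -- hence at most `τ` in all; the leading bits of the last item add another `τ`, and 2 τ units make
  -- `N`.
  hits⇒accepting : ∀ {n} t (a : Instance (suc n) b) y → t < 2 ^ h → suc (suc n) ≤ τ →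
    ∏ (hit h g t) (targets (suc n) τ) a ≢ 0 →
    let k = multiplier h g t ; rs = residues b k a in
    k < N × k % N + Vec.sum rs < N × N ≤ 2 * finalOr y rs
  hits⇒accepting {n} t a y t<T n≤τ ≢0 with lt , le ← hits⇒residues t a y ≢0 =
    ≤-<-trans k≤U U<N ,
    (begin-strict
      k % N + Vec.sum (residues b k a)  ≤⟨ +-monoˡ-≤ _ (≤-trans (m%n≤m k N) k≤U) ⟩
      U + Vec.sum (residues b k a)      <⟨ +-monoʳ-< U lt ⟩
      U + (suc n * U + τ * U)           ≡⟨ +-assoc U (suc n * U) (τ * U) ⟨
      suc (suc n) * U + τ * U           ≤⟨ +-monoˡ-≤ (τ * U) (*-monoˡ-≤ U n≤τ) ⟩
      τ * U + τ * U                     ≡⟨ N≡τU+τU ⟨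
      N ∎) ,
    (begin
      N                             ≡⟨ N≡τU+τU ⟩
      τ * U + τ * U                 ≡⟨ cong (τ * U +_) (+-identityʳ (τ * U)) ⟨
      2 * (τ * U)                   ≤⟨ *-monoʳ-≤ 2 le ⟩
      2 * finalOr y (residues b k a) ∎)
    where
    open ≤-Reasoning
    k : ℕ
    k = multiplier h g t
    N≡τU+τU : N ≡ τ * U + τ * U
    N≡τU+τU = trans N≡PU (regroup τ U)
      where
      regroup : ∀ τ U → (2 * τ) * U ≡ τ * U + τ * U
      regroup = solve-∀
    k≤U : k ≤ U
    k≤U = begin
      1 + t * M     ≤⟨ +-monoˡ-≤ (t * M) (m^n>0 2 m) ⟩
      suc t * M     ≤⟨ *-monoˡ-≤ M t<T ⟩
      2 ^ h * M     ≡⟨ *-comm (2 ^ h) M ⟩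
      M * 2 ^ h     ≡⟨ ^-distribˡ-+-* 2 m h ⟨
      U             ∎
    U<N : U < N
    U<N = begin-strict
      U             ≡⟨ +-identityʳ U ⟨
      1 * U         <⟨ *-monoˡ-< U {{m^n≢0 2 (m + h)}} (^-monoʳ-< 2 (s<s z<s) {0} {g} z<s) ⟩
      P * U         ≡⟨ N≡PU ⟨
      N             ∎

-- Acceptance: decidability, completeness and soundness

-- Determinism identifies an arbitrary accepting run with the one built in `main-runs`.
accepts⇔ : ∀ n b (a : Instance n b) w → Accepts verifier n b a w ⇔
           head (answer n b (encode n b a) w (w ʳ++ []) [] []) ≡ just true
accepts⇔ n b a w =
  let s , eq , runs _ run = main-runs {b} n (encode n b a) w in mk⇔
  (λ (s′ , _ , run′ , h) →
    trans (cong head (trans (sym eq) (cong (λ s → lookup s Fin.zero) (proj₁ (deterministic run run′))))) h)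
  (λ h → s , _ , run , trans (cong head eq) h)

accepts? : ∀ n b (a : Instance n b) → Decidable (Accepts verifier n b a)
accepts? n b a w = map′ from to (≡-decᴹ _≟ᵇ_ _ _)
  where open Equivalence (accepts⇔ n b a w)

-- Exhaustive search, since counting the certified instances calls for a decision procedure.
∃-bounded? : ∀ {Q : Pred (List Bool) 0ℓ} → Decidable Q → ∀ l → Dec (∃[ w ] length w ≤ l × Q w)
∃-bounded? Q? zero = map′ (λ q → [] , z≤n , q) (λ { ([] , _ , q) → q }) (Q? [])
∃-bounded? Q? (suc l) =
  map′ (λ { (inj₁ q) → [] , z≤n , q
          ; (inj₂ (inj₁ (w , le , q))) → false ∷ w , s≤s le , q
          ; (inj₂ (inj₂ (w , le , q))) → true ∷ w , s≤s le , q })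
       (λ { ([] , _ , q) → inj₁ q
          ; (false ∷ w , s≤s le , q) → inj₂ (inj₁ (w , le , q))
          ; (true ∷ w , s≤s le , q) → inj₂ (inj₂ (w , le , q)) })
       (Q? [] ⊎-dec (∃-bounded? (Q? ∘ (false ∷_)) l ⊎-dec ∃-bounded? (Q? ∘ (true ∷_)) l))

accepts⇔residues : ∀ n b (a : Instance n b) w → let k = val (w ʳ++ []) ; rs = residues b k a in
  Accepts verifier n b a w ⇔
  ((k % 2 ^ b) {{m^n≢0 2 b}} + Vec.sum rs < 2 ^ b × 2 ^ b ≤ 2 * finalOr 0 rs)
accepts⇔residues n b a w = mk⇔
  (λ acc → proj₂ (A.to (E.to acc)))
  (λ (lt , le) → E.from (A.from (refl , lt , le)))
  where
  module E = Equivalence (accepts⇔ n b a w)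
  module A = Equivalence (answer-accepts b w a (w ʳ++ []) [] [] (headIsTop-mulBits b w [] []))

accepted : ∀ n b (a : Instance n b) k → let rs = residues b k a in k < 2 ^ b →
  (k % 2 ^ b) {{m^n≢0 2 b}} + Vec.sum rs < 2 ^ b → 2 ^ b ≤ 2 * finalOr 0 rs →
  ∃[ w ] length w ≤ b × Accepts verifier n b a w
accepted n b a k k<2^b lt le =
  w , ≤-reflexive (trans (length-reverse (binary b k)) (length-binary b k)) ,
  Equivalence.from (accepts⇔residues n b a w)
    (subst (λ k → (k % 2 ^ b) {{m^n≢0 2 b}} + Vec.sum (residues b k a) < 2 ^ b ×
                  2 ^ b ≤ 2 * finalOr 0 (residues b k a))
      (sym val-w) (lt , le))
  where
  w : List Bool
  -- `binary` writes the least significant bit first, while the verifier reads the witness from the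
  -- most significant one.
  w = List.reverse (binary b k)
  val-w : val (w ʳ++ []) ≡ k
  val-w = trans (cong val (trans (reverse-involutive (binary b k)) (sym (++-identityʳ (binary b k)))))
    (trans (val-binary-++ b [] k<2^b) (+-identityʳ k))

sound : ∀ n b .{{_ : NonZero n}} (a : Instance n b) → HasPerfectPartition (integers a) →
        ¬ (∃[ w ] Accepts verifier n b a w)
sound (suc n) b a part (w , acc) =
  let lt , le = Equivalence.to (accepts⇔residues (suc n) b a w) acc in
  ≤⇒≯ le (no-perfectPartition b (val (w ʳ++ [])) a 0 part lt)

-- Copies the shape of `mainTime n b b`, so that its value unfolds definitionally to the running
-- time for a witness of b bits.
timePolynomial : Polynomial
timePolynomial = 𝐧 ⊗ (con 1 ⊕ stepP) ⊕ 𝐛 ⊗ con 4 ⊕ 𝐛 ⊗ con 4 ⊕ con 9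
  where
  addP mulP stepP : Polynomial
  addP  = 𝐛 ⊗ con 19 ⊕ con 5
  mulP  = 𝐛 ⊗ (con 1 ⊕ (addP ⊕ con 8)) ⊕ con 3
  stepP = mulP ⊕ addP ⊕ 𝐛 ⊗ con 3 ⊕ con 10

mainTime-mono : ∀ n b {l l′} → l ≤ l′ → mainTime n b l ≤ mainTime n b l′
mainTime-mono n b le =
  +-monoˡ-≤ 9 (+-monoˡ-≤ (b * 4) (+-mono-≤
    (*-monoʳ-≤ n (s≤s (+-monoˡ-≤ 10 (+-monoˡ-≤ (b * 3) (+-monoˡ-≤ (addTime b)
      (+-monoˡ-≤ 3 (*-monoˡ-≤ (suc (mulStepTime b)) le)))))))
    (*-monoˡ-≤ 4 le)))

halts : ∀ n b (a : Instance n b) w → length w ≤ b → HaltsWithin verifier n b a w (⟦ timePolynomial ⟧ n b)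
halts n b a w le =
  let s , _ , runs bound run = main-runs {b} n (encode n b a) w in
  s , _ , ≤-trans bound (mainTime-mono n b le) , run

-- Logarithms and rational estimates

n<2^[1+⌊log₂n⌋] : ∀ n → n < 2 ^ suc ⌊log₂ n ⌋
n<2^[1+⌊log₂n⌋] n with n <? 2 ^ suc ⌊log₂ n ⌋
... | yes lt = lt
... | no  ge = contradiction
  (subst (_≤ ⌊log₂ n ⌋) (⌊log₂[2^n]⌋≡n (suc ⌊log₂ n ⌋)) (⌊log₂⌋-mono-≤ (≮⇒≥ ge))) 1+n≰n

toℚᵘ-/ : ∀ i d .{{_ : NonZero d}} → toℚᵘ (i ℚ./ d) ℚᵘ.≃ (i ℚᵘ./ d)
toℚᵘ-/ i (suc d) = ℚ.toℚᵘ-fromℚᵘ (mkℚᵘ i d)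

ℕ→ℚ-* : ∀ x y → ℕ→ℚ (x * y) ≡ ℕ→ℚ x ℚ.* ℕ→ℚ y
ℕ→ℚ-* x y = ℚ.toℚᵘ-injective (begin
  toℚᵘ (ℕ→ℚ (x * y))                       ≈⟨ toℚᵘ-/ (ℤ.+ (x * y)) 1 ⟩
  mkℚᵘ (ℤ.+ (x * y)) 0                     ≡⟨ cong (λ i → mkℚᵘ i 0) (ℤ.pos-* x y) ⟩
  mkℚᵘ (ℤ.+ x) 0 ℚᵘ.* mkℚᵘ (ℤ.+ y) 0       ≈⟨ ℚᵘ.*-cong (toℚᵘ-/ (ℤ.+ x) 1) (toℚᵘ-/ (ℤ.+ y) 1) ⟨
  toℚᵘ (ℕ→ℚ x) ℚᵘ.* toℚᵘ (ℕ→ℚ y)           ≈⟨ ℚ.toℚᵘ-homo-* (ℕ→ℚ x) (ℕ→ℚ y) ⟨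
  toℚᵘ (ℕ→ℚ x ℚ.* ℕ→ℚ y)                   ∎)
  where open import Relation.Binary.Reasoning.Setoid ℚᵘ.≃-setoid

ℕ→ℚ-mono-≤ : ∀ {x y} → x ≤ y → ℕ→ℚ x ℚ.≤ ℕ→ℚ y
ℕ→ℚ-mono-≤ {x} {y} x≤y = ℚ.toℚᵘ-cancel-≤ (begin
  toℚᵘ (ℕ→ℚ x)   ≃⟨ toℚᵘ-/ (ℤ.+ x) 1 ⟩
  mkℚᵘ (ℤ.+ x) 0 ≤⟨ *≤* (ℤ.*-monoʳ-≤-nonNeg (ℤ.+ 1) (ℤ.+≤+ x≤y)) ⟩
  mkℚᵘ (ℤ.+ y) 0 ≃⟨ toℚᵘ-/ (ℤ.+ y) 1 ⟨
  toℚᵘ (ℕ→ℚ y)   ∎)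
  where open ℚᵘ.≤-Reasoning

-- The last hypothesis says that G / D is at least 1 - 1 / μ, and a positive rational is at least
-- the reciprocal of its denominator, hence at least 1 / μ.
1-ε≤G/D : ∀ {ε} μ G D .{{_ : NonZero D}} → 0ℚ ℚ.< ε → ↧ₙ ε ≤ μ → μ * D ≤ D + μ * G →
          1ℚ ℚ.- ε ℚ.≤ ℤ.+ G ℚ./ D
1-ε≤G/D {mkℚ (ℤ.+ zero) _ _}  μ G D (ℚ.*<* (ℤ.+<+ ()))
1-ε≤G/D {mkℚ (ℤ.-[1+ _ ]) _ _} μ G D (ℚ.*<* ())
1-ε≤G/D {ε@(mkℚ (ℤ.+ suc p) q-1 _)} μ G D@(suc _) 0<ε q≤μ le = begin
  1ℚ ℚ.- ε                       ≤⟨ ℚ.+-monoˡ-≤ (ℚ.- ε) (ℚ.toℚᵘ-cancel-≤ {1ℚ} {ℤ.+ G ℚ./ D ℚ.+ ε} 1≤) ⟩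
  ℤ.+ G ℚ./ D ℚ.+ ε ℚ.- ε        ≡⟨ ℚ.+-assoc (ℤ.+ G ℚ./ D) ε (ℚ.- ε) ⟩
  ℤ.+ G ℚ./ D ℚ.+ (ε ℚ.- ε)      ≡⟨ cong (ℤ.+ G ℚ./ D ℚ.+_) (ℚ.+-inverseʳ ε) ⟩
  ℤ.+ G ℚ./ D ℚ.+ 0ℚ             ≡⟨ ℚ.+-identityʳ _ ⟩
  ℤ.+ G ℚ./ D                    ∎
  where
  open ℚ.≤-Reasoning
  q : ℕ
  q = suc q-1
  Dq≤Gq+D : D * q ≤ G * q + D
  Dq≤Gq+D with ≤-total D G
  ... | inj₁ D≤G = ≤-trans (*-monoˡ-≤ q D≤G) (m≤m+n (G * q) D)
  ... | inj₂ G≤D with x , eq ← m≤n⇒∃[o]m+o≡n G≤D =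
    ≤-trans (≤-reflexive (trans (cong (_* q) (sym eq)) (*-distribʳ-+ q G x)))
      (+-monoʳ-≤ (G * q) (≤-trans (≤-reflexive (*-comm x q))
        (≤-trans (*-monoˡ-≤ x q≤μ) (+-cancelʳ-≤ (μ * G) (μ * x) D
          (≤-trans (≤-reflexive (trans (+-comm (μ * x) (μ * G))
            (trans (sym (*-distribˡ-+ μ G x)) (cong (μ *_) eq)))) le)))))
  cross : ℤ.1ℤ ℤ.* (ℤ.+ (D * q)) ℤ.≤ (ℤ.+ G ℤ.* ℤ.+ q ℤ.+ ℤ.+ suc p ℤ.* ℤ.+ D) ℤ.* ℤ.1ℤ
  cross = subst₂ ℤ._≤_ (sym (ℤ.*-identityˡ _))
    (trans (trans (ℤ.pos-+ (G * q) (suc p * D)) (cong₂ ℤ._+_ (ℤ.pos-* G q) (ℤ.pos-* (suc p) D)))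
      (sym (ℤ.*-identityʳ _)))
    (ℤ.+≤+ (≤-trans Dq≤Gq+D (+-monoʳ-≤ (G * q) (m≤m+n D (p * D)))))
  1≤ : toℚᵘ 1ℚ ℚᵘ.≤ toℚᵘ (ℤ.+ G ℚ./ D ℚ.+ ε)
  1≤ = ℚᵘ.≤-respʳ-≃
    (ℚᵘ.≃-sym (ℚᵘ.≃-trans (ℚ.toℚᵘ-homo-+ (ℤ.+ G ℚ./ D) ε) (ℚᵘ.+-congˡ (toℚᵘ ε) (toℚᵘ-/ (ℤ.+ G) D))))
    (*≤* cross)

-- Choice of parameters

-- About 2 n * exponent n bits would do; the factor 6 leaves room for making the width a multiple
-- of n, and then α is an integer.
exponent width : ℕ → ℕ
exponent n = suc (suc ⌊log₂ n ⌋)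
width n = 6 * exponent n * n

Certified : ∀ n → Pred (Instance n (width n)) _
Certified n a = ∃[ w ] length w ≤ ⟦ 𝐛 ⟧ n (width n) × Accepts verifier n (width n) a w

certified? : ∀ n → Decidable (Certified n)
certified? n a = ∃-bounded? (accepts? n (width n) a) (width n)

-- The failure probability is at most 2 ^ -e, which is at most 1 / n, so the denominator of `ε` can
-- serve as threshold. Being positive, it also rules out n = 0.
whp : WithHighProbability width Certified
whp = certified? , λ ε 0<ε → ↧ₙ ε , bound ε 0<ε
  where
  bound : ∀ ε → 0ℚ ℚ.< ε → ∀ n → ↧ₙ ε ≤ n → 1ℚ ℚ.- ε ℚ.≤ ℙ {{m^n≢0 2 (width n)}} (certified? n)
  bound ε 0<ε (suc n) q≤n =
    1-ε≤G/D {ε} (2 ^ e) (length (List.filter (certified? (suc n)) (allVecs N (suc n)))) (N ^ suc n)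
      {{m^n≢0 N (suc n) {{m^n≢0 2 b}}}} 0<ε (≤-trans q≤n n≤μ)
      (secondMoment (certified? (suc n)) (allVecs N (suc n)) (hits h g refl N≡ σs)
        (2 ^ e) (N ^ suc n) {{m^n≢0 2 e}} zeros
        (∑-hits h g refl N≡ σs) (∑-hits² h g refl N≡ σs))
    where
    b g e h N : ℕ
    b = width (suc n)
    g = exponent (suc n)
    -- What the width leaves over: with `suc n` items, b = 2 (h + g) gives h + g = 3 g (n + 1), and
    -- h = e + g (n + 1) then determines e.
    e = g * (2 * n + 1)
    h = e + g * suc n
    N = 2 ^ b
    b≡ : b ≡ (h + g) + (h + g)
    b≡ = regroup g n
      where
      regroup : ∀ g n → 6 * g * suc n ≡ (g * (2 * n + 1) + g * suc n + g) + (g * (2 * n + 1) + g * suc n + g)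
      regroup = solve-∀
    N≡ : N ≡ 2 ^ (h + g) * 2 ^ (h + g)
    N≡ = trans (cong (2 ^_) b≡) (^-distribˡ-+-* 2 (h + g) (h + g))
    σs : Vec ℕ (suc n)
    -- This power of two exceeds the number of items, as the budget in `hits⇒accepting` requires,
    -- and its exponent is g - 1.
    σs = targets (suc n) (2 ^ suc ⌊log₂ suc n ⌋)
    n≤μ : suc n ≤ 2 ^ e
    n≤μ = begin
      suc n                     ≤⟨ n≤1+n (suc n) ⟩
      suc (suc n)               ≤⟨ n<2^[1+⌊log₂n⌋] (suc n) ⟩
      2 ^ suc ⌊log₂ suc n ⌋     ≤⟨ ^-monoʳ-≤ 2 (n≤1+n (suc ⌊log₂ suc n ⌋)) ⟩
      2 ^ g                     ≤⟨ ^-monoʳ-≤ 2 (m≤m*n g (2 * n + 1) {{subst NonZero (+-comm 1 (2 * n)) _}}) ⟩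
      2 ^ e                     ∎
      where open ≤-Reasoning
    zeros : ∀ a → ¬ Certified (suc n) a → hits h g refl N≡ σs a ≡ 0
    zeros a ¬cert = trans (∑<-cong (2 ^ h) zero-at) (trans (∑<-const (2 ^ h) 0) (*-zeroʳ (2 ^ h)))
      where
      zero-at : ∀ t → t < 2 ^ h → ∏ (hit h g t) σs a ≡ 0
      zero-at t t<T with ∏ (hit h g t) σs a ≟ 0
      ... | yes eq = eq
      ... | no ≢0 =
        let k<N , lt , le = hits⇒accepting h (suc ⌊log₂ suc n ⌋) b b≡ t a 0 t<T (n<2^[1+⌊log₂n⌋] (suc n)) ≢0
        in contradiction (accepted (suc n) b a (multiplier h g t) k<N lt le) ¬cert

6*exponent≤18*log : ∀ n → 2 ≤ n → 6 * exponent n ≤ 18 * ⌊log₂ n ⌋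
6*exponent≤18*log n 2≤n = begin
  6 * (2 + ⌊log₂ n ⌋)          ≡⟨ *-distribˡ-+ 6 2 ⌊log₂ n ⌋ ⟩
  12 + 6 * ⌊log₂ n ⌋           ≤⟨ +-monoˡ-≤ (6 * ⌊log₂ n ⌋) (*-monoʳ-≤ 12 (⌊log₂⌋-mono-≤ 2≤n)) ⟩
  12 * ⌊log₂ n ⌋ + 6 * ⌊log₂ n ⌋ ≡⟨ *-distribʳ-+ ⌊log₂ n ⌋ 12 6 ⟨
  18 * ⌊log₂ n ⌋ ∎
  where open ≤-Reasoning

α : ℕ → ℚ
α n = ℕ→ℚ (6 * exponent n)

α-O[log] : O[log] α
α-O[log] = ℕ→ℚ 18 , 2 , λ n 2≤n → begin
  ℚ.∣ α n ∣                        ≡⟨ ℚ.0≤p⇒∣p∣≡p (ℕ→ℚ-mono-≤ {0} {6 * exponent n} z≤n) ⟩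
  α n                              ≤⟨ ℕ→ℚ-mono-≤ (6*exponent≤18*log n 2≤n) ⟩
  ℕ→ℚ (18 * ⌊log₂ n ⌋)             ≡⟨ ℕ→ℚ-* 18 ⌊log₂ n ⌋ ⟩
  ℕ→ℚ 18 ℚ.* ℕ→ℚ ⌊log₂ n ⌋         ∎
  where open ℚ.≤-Reasoning

theorem1p4 : Σ[ α ∈ (ℕ → ℚ) ] Σ[ b ∈ (ℕ → ℕ) ]
    O[log] α
    × (∀ n → .{{_ : NonZero n}} → 0 < b n × ℕ→ℚ (b n) ≡ α n ℚ.* ℕ→ℚ n)
    × (Σ[ V ∈ Verifier ] Σ[ time ∈ Polynomial ] Σ[ size ∈ Polynomial ]
    (∀ n → .{{_ : NonZero n}} → (a : Instance n (b n)) (w : Witness) →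
    length w ≤ ⟦ size ⟧ n (b n) → HaltsWithin V n (b n) a w (⟦ time ⟧ n (b n)))
    × (∀ n → .{{_ : NonZero n}} → (a : Instance n (b n)) →
    HasPerfectPartition (integers a) → ¬ (∃[ w ] Accepts V n (b n) a w))
    × WithHighProbability b (λ n a →
    ∃[ w ] length w ≤ ⟦ size ⟧ n (b n) × Accepts V n (b n) a w))
theorem1p4 =
  α , width , α-O[log] ,
  (λ { n@(suc _) → z<s , ℕ→ℚ-* (6 * exponent n) n }) ,
  verifier , timePolynomial , 𝐛 ,
  (λ n → halts n (width n)) ,
  (λ n → sound n (width n)) ,
  whp
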